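{- Let $r\ge 3$ and $n\ge 1$ be integers. Then $$ex_r^{\mathrm{lin}}(n,B_4^r)\le \frac{(r+1)n}{r}.$$ Moreover, if a Steiner system $S(2,r,r^2)$ exists, then a linear $r$-uniform hypergraph $H$ on $n$ vertices is $B_4^r$-free with $|E(H)|=\frac{(r+1)n}{r}$ if and only if $H$ is a vertex-disjoint union of Steiner systems $S(2,r,r^2)$.
   Context: All hypergraphs are finite. A hypergraph is $r$-uniform if each hyperedge has exactly $r$ vertices, and linear if any two distinct hyperedges intersect in at most one vertex. A hypergraph $H$ contains $F$ as a subhypergraph if there is an injective map $V(F)\to V(H)$ sending every hyperedge of $F$ to a hyperedge of $H$; otherwise $H$ is $F$-free. The linear Turán number $ex_r^{\mathrm{lin}}(n,F)$ is the maximum number of hyperedges in an $F$-free linear $r$-uniform hypergraph on $n$ vertices. The expansion $G^r$ of a graph $G$ is the $r$-uniform hypergraph obtained by enlarging each edge of $G$ with $r-2$ new vertices, the new vertices for different edges being distinct. $B_4$ is the tree with four edges obtained from the star $S_3$ with three edges by attaching an extra edge at a leaf, and $B_4^r$ is its expansion; explicitly, $B_4^r$ consists of four hyperedges $e_1,e_2,e_3,e_4$ of size $r$ where $e_1,e_2,e_3$ share exactly one common vertex $v$ and are otherwise pairwise disjoint, $e_4$ meets $e_3$ in exactly one vertex different from $v$, and $e_4$ is disjoint from $e_1\cup e_2$. A Steiner system $S(2,r,m)$ is a set of $m$ vertices together with a family of $r$-element subsets (blocks, viewed as hyperedges) such that every pair of distinct vertices lies in exactly one block. -}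

module Defs where

open import Data.Bool using (Bool; true; false; if_then_else_)
import Data.Bool.Properties as Bool
open import Data.Empty using (⊥-elim)
open import Data.Fin using (Fin; zero; suc; #_; funToFin; finToFun)
import Data.Fin.Properties as Fin
open import Data.Fin.Subset using (Subset; _∈_; _⊆_; _∩_; _∪_; ∣_∣; ⁅_⁆; ⊤)
open import Data.Fin.Subset.Properties using (_∈?_; anySubset?)
open import Data.List as List using (List; []; _∷_; length)
open import Data.List.Membership.Propositional renaming (_∈_ to _∈ₗ_)
open import Data.List.Membership.Propositional.Properties using (∈-lookup)
open import Data.List.Relation.Unary.All as All using (All; []; _∷_)
open import Data.List.Relation.Unary.AllPairs using (allPairs?; []; _∷_)
open import Data.List.Relation.Unary.Any as Any using (here)
open import Data.List.Relation.Unary.Unique.Propositional using (Unique)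
open import Data.List.Relation.Unary.Unique.Propositional.Properties using (tabulate⁺)
open import Data.Nat using (ℕ; zero; suc; _+_; _*_; _∸_; _^_; _≤_; NonZero)
import Data.Nat.Properties as ℕ
open import Data.Product using (Σ-syntax; ∃; ∃-syntax; ∃!; _×_; _,_; proj₁; proj₂)
open import Data.Vec as Vec using (_++_; lookup; tabulate)
import Data.Vec.Properties as Vec
open import Function using (_∘_; _∋_; _⇔_; mk⇔; Injective; case_of_)
open import Relation.Binary.Definitions using (DecidableEquality)
open import Relation.Binary.PropositionalEquality
open import Relation.Nullary using (¬_; Dec; yes; no; does)
open import Relation.Nullary.Decidable using (map′; _×-dec_; _→-dec_; ¬?; does-⇔; from-yes)
open import Relation.Unary using (Decidable)

private
  variable
    m n : ℕ

_≟ˢ_ : DecidableEquality (Subset n)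
_≟ˢ_ = Vec.≡-dec Bool._≟_

record Hypergraph (n : ℕ) : Set where
  constructor hypergraph
  field
    edges  : List (Subset n)
    unique : Unique edges

open Hypergraph public

infix 4 _∈ᴱ_

_∈ᴱ_ : Subset n → Hypergraph n → Set
e ∈ᴱ H = e ∈ₗ edges H

size : Hypergraph n → ℕ
size H = length (edges H)

Uniform : ℕ → Hypergraph n → Set
Uniform r H = ∀ e → e ∈ᴱ H → ∣ e ∣ ≡ r

Linear : Hypergraph n → Set
Linear H = ∀ e f → e ∈ᴱ H → f ∈ᴱ H → e ≢ f → ∣ e ∩ f ∣ ≤ 1

image : (Fin m → Fin n) → Subset m → Subset n
image f e = tabulate λ y → does (Fin.any? λ x → (x ∈? e) ×-dec (f x Fin.≟ y))

Contains : Hypergraph n → Hypergraph m → Set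
Contains {n} {m} H F =
  Σ[ f ∈ (Fin m → Fin n) ] Injective _≡_ _≡_ f × (∀ e → e ∈ᴱ F → image f e ∈ᴱ H)

Free : Hypergraph m → Hypergraph n → Set
Free F H = ¬ Contains H F

private
  lookup-injective : {A : Set} {xs : List A} → Unique xs →
                     ∀ {i j} → List.lookup xs i ≡ List.lookup xs j → i ≡ j
  lookup-injective (_ ∷ _)   {zero}  {zero}  _  = refl
  lookup-injective (x∉ ∷ _)  {zero}  {suc j} eq = ⊥-elim (All.lookup x∉ (∈-lookup j) eq)
  lookup-injective (x∉ ∷ _)  {suc i} {zero}  eq = ⊥-elim (All.lookup x∉ (∈-lookup i) (sym eq))
  lookup-injective (_ ∷ xs!) {suc i} {suc j} eq = cong suc (lookup-injective xs! eq)

-- The vertices are the p vertices of G, followed by one group of r ∸ 2 new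
-- vertices for each edge of G; the i-th edge is enlarged by the i-th group.
expandedEdge : ∀ {p} (r : ℕ) (G : Hypergraph p) → Fin (size G) → Subset (p + size G * (r ∸ 2))
expandedEdge r G i =
  List.lookup (edges G) i ++ Vec.concat (Vec.map (Vec.replicate (r ∸ 2)) ⁅ i ⁆)

-- Only meant for r ≥ 2 and G a graph, that is, a 2-uniform hypergraph.
expansion : ∀ {p} (r : ℕ) (G : Hypergraph p) → Hypergraph (p + size G * (r ∸ 2))
expansion r G = hypergraph (List.tabulate (expandedEdge r G))
  (tabulate⁺ λ {i} {j} eq → lookup-injective (unique G)
    (Vec.++-injectiveˡ (List.lookup (edges G) i) (List.lookup (edges G) j) eq))

B₄ : Hypergraph 5
B₄ = hypergraph es (from-yes (allPairs? (λ e f → ¬? (e ≟ˢ f)) es))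
  where
  pair : Fin 5 → Fin 5 → Subset 5
  pair x y = ⁅ x ⁆ ∪ ⁅ y ⁆

  es : List (Subset 5)
  es = pair (# 0) (# 1) ∷ pair (# 0) (# 2) ∷ pair (# 0) (# 3) ∷ pair (# 3) (# 4) ∷ []

B₄-isGraph : Uniform 2 B₄
B₄-isGraph e = All.lookup (from-yes (All.all? (λ e → ∣ e ∣ ℕ.≟ 2) (edges B₄)))

LinearFree : ℕ → Hypergraph m → Hypergraph n → Set
LinearFree r F H = Uniform r H × Linear H × Free F H

record IsLinearTuránNumber (r n : ℕ) (F : Hypergraph m) (k : ℕ) : Set where
  field
    attained : Σ[ H ∈ Hypergraph n ] LinearFree r F H × size H ≡ k
    maximal  : (H : Hypergraph n) → LinearFree r F H → size H ≤ k

private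
  allEdges? : {P : Subset n → Set} → Decidable P → (H : Hypergraph n) →
              Dec (∀ e → e ∈ᴱ H → P e)
  allEdges? P? H = map′ (λ a e → All.lookup a) (λ g → All.tabulate λ {e} → g e)
                        (All.all? P? (edges H))

  _∈ᴱ?_ : (e : Subset n) (H : Hypergraph n) → Dec (e ∈ᴱ H)
  e ∈ᴱ? H = Any.any? (e ≟ˢ_) (edges H)

  image-cong : {f g : Fin m → Fin n} → f ≗ g → ∀ e → image f e ≡ image g e
  image-cong {f = f} {g} f≗g e = Vec.tabulate-cong λ y → does-⇔
    (mk⇔ (λ (x , x∈e , eq) → x , x∈e , trans (sym (f≗g x)) eq)
         (λ (x , x∈e , eq) → x , x∈e , trans (f≗g x) eq))
    (Fin.any? λ x → (x ∈? e) ×-dec (f x Fin.≟ y))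
    (Fin.any? λ x → (x ∈? e) ×-dec (g x Fin.≟ y))

  anyFun? : {P : (Fin m → Fin n) → Set} → (∀ {f g} → f ≗ g → P f → P g) →
            Decidable P → Dec (∃ P)
  anyFun? resp P? = map′
    (λ (_ , p) → _ , p)
    (λ (f , p) → funToFin f , resp (λ x → sym (Fin.finToFun-funToFin f x)) p)
    (Fin.any? (P? ∘ finToFun))

  contains? : (H : Hypergraph n) (F : Hypergraph m) → Dec (Contains H F)
  contains? H F = anyFun?
    (λ {f} {g} f≗g (inj , emb) →
      (λ eq → inj (trans (f≗g _) (trans eq (sym (f≗g _))))) ,
      (λ e e∈ → subst (_∈ᴱ H) (image-cong f≗g e) (emb e e∈)))
    (λ f → injective? f ×-dec allEdges? (λ e → image f e ∈ᴱ? H) F)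
    where
    injective? : ∀ f → Dec (Injective _≡_ _≡_ f)
    injective? f = map′ (λ g {x} {y} → g x y) (λ g x y → g)
      (Fin.all? λ x → Fin.all? λ y → (f x Fin.≟ f y) →-dec (x Fin.≟ y))

  linearFree? : (r : ℕ) (F : Hypergraph m) (H : Hypergraph n) → Dec (LinearFree r F H)
  linearFree? r F H =
    allEdges? (λ e → ∣ e ∣ ℕ.≟ r) H
    ×-dec map′ (λ g e f e∈ f∈ → g e e∈ f f∈) (λ g e e∈ f f∈ → g e f e∈ f∈)
      (allEdges? (λ e → allEdges? (λ f → ¬? (e ≟ˢ f) →-dec (∣ e ∩ f ∣ ℕ.≤? 1)) H) H)
    ×-dec ¬? (contains? H F)

  anyList? : ∀ k {P : List (Subset n) → Set} → Decidable P →
             Dec (Σ[ es ∈ List (Subset n) ] P es × length es ≡ k)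
  anyList? zero P? = map′ (λ p → [] , p , refl) (λ { ([] , p , _) → p }) (P? [])
  anyList? (suc k) P? = map′
    (λ (e , es , p , eq) → e ∷ es , p , cong suc eq)
    (λ { (e ∷ es , p , eq) → e , es , p , ℕ.suc-injective eq })
    (anySubset? λ e → anyList? k (P? ∘ (e ∷_)))

  attained? : (r : ℕ) (F : Hypergraph m) (k : ℕ) →
              Dec (Σ[ H ∈ Hypergraph n ] LinearFree r F H × size H ≡ k)
  attained? {n = n} r F k = map′
    (λ (es , (es! , p) , eq) → hypergraph es es! , p , eq)
    (λ (H , p , eq) → edges H , (unique H , p) , eq)
    (anyList? k λ es → dec es (allPairs? (λ e f → ¬? (e ≟ˢ f)) es))
    where
    dec : (es : List (Subset n)) → Dec (Unique es) →
          Dec (Σ[ es! ∈ Unique es ] LinearFree r F (hypergraph es es!))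
    dec es (no ¬es!) = no (¬es! ∘ proj₁)
    dec es (yes es!) = map′ (es! ,_) proj₂ (linearFree? r F (hypergraph es es!))

  encode : Subset n → Fin (2 ^ n)
  encode e = funToFin λ x → toFin (lookup e x)
    where
    toFin : Bool → Fin 2
    toFin b = if b then # 1 else # 0

  encode-injective : Injective _≡_ _≡_ (encode {n})
  encode-injective {x = d} {y = e} eq = begin
    d                   ≡⟨ Vec.tabulate∘lookup d ⟨
    tabulate (lookup d) ≡⟨ Vec.tabulate-cong pointwise ⟩
    tabulate (lookup e) ≡⟨ Vec.tabulate∘lookup e ⟩
    e                   ∎
    where
    open ≡-Reasoning

    toFin-injective : ∀ a b → (if a then # 1 else # 0) ≡ (Fin 2 ∋ (if b then # 1 else # 0)) → a ≡ b
    toFin-injective true  true  _ = refl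
    toFin-injective false false _ = refl

    pointwise : lookup d ≗ lookup e
    pointwise x = toFin-injective _ _ (trans (sym (Fin.finToFun-funToFin _ x))
      (trans (cong (λ c → finToFun c x) eq) (Fin.finToFun-funToFin _ x)))

  size≤2^n : (H : Hypergraph n) → size H ≤ 2 ^ n
  size≤2^n H = Fin.injective⇒≤ {f = encode ∘ List.lookup (edges H)}
    (λ eq → lookup-injective (unique H) (encode-injective eq))

  greatest : {P : ℕ → Set} → Decidable P → P 0 → ∀ b → (∀ k → P k → k ≤ b) →
             ∃[ k ] P k × (∀ j → P j → j ≤ k)
  greatest P? p₀ zero    bound = 0 , p₀ , bound
  greatest P? p₀ (suc b) bound with P? (suc b)
  ... | yes p = suc b , p , bound
  ... | no ¬p = greatest P? p₀ b λ k p →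
    ℕ.≤-pred (ℕ.≤∧≢⇒< (bound k p) λ { refl → ¬p p })

  empty-linearFree : ∀ r n (F : Hypergraph m) .{{_ : NonZero (size F)}} →
                     LinearFree r F (hypergraph {n} [] [])
  empty-linearFree r n (hypergraph (e ∷ es) _) =
    (λ _ ()) , (λ _ _ ()) , λ (_ , _ , emb) → case emb e (here refl) of λ ()

linearTuránNumber : ∀ r n (F : Hypergraph m) .{{_ : NonZero (size F)}} →
                    ∃[ k ] IsLinearTuránNumber r n F k
linearTuránNumber r n F =
  let k , attained , maximal = greatest (attained? r F)
        (hypergraph [] [] , empty-linearFree r n F , refl) (2 ^ n)
        (λ { _ (H , _ , refl) → size≤2^n H })
  in k , record { attained = attained ; maximal = λ H p → maximal _ (H , p , refl) }

-- If F had no edges there could be no F-free hypergraph at all on n vertices.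
exˡⁱⁿ : ∀ r n (F : Hypergraph m) .{{_ : NonZero (size F)}} → ℕ
exˡⁱⁿ r n F = proj₁ (linearTuránNumber r n F)

-- S is a Steiner system S(2,r,m) with point set X.  The point set may be a
-- proper subset of the ambient Fin n.
record IsSteinerSystem (r m : ℕ) (X : Subset n) (S : Hypergraph n) : Set where
  field
    points    : ∣ X ∣ ≡ m
    supported : ∀ e → e ∈ᴱ S → e ⊆ X
    uniform   : Uniform r S
    pairs     : ∀ x y → x ∈ X → y ∈ X → x ≢ y →
                ∃! _≡_ λ e → e ∈ᴱ S × x ∈ e × y ∈ e

SteinerSystemExists : ℕ → ℕ → Set
SteinerSystemExists r m = Σ[ S ∈ Hypergraph m ] IsSteinerSystem r m ⊤ S

record IsDisjointUnionOfSteinerSystems (r m : ℕ) (H : Hypergraph n) : Set where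
  field
    count     : ℕ
    part      : Fin count → Subset n
    system    : Fin count → Hypergraph n
    steiner   : ∀ i → IsSteinerSystem r m (part i) (system i)
    partition : ∀ x → ∃! _≡_ λ i → x ∈ part i
    union     : ∀ e → e ∈ᴱ H ⇔ (∃[ i ] e ∈ᴱ system i)

{-# OPTIONS --safe #-}
module Submission where

-- Let v lie on an edge e, let w ≢ v be on e, and let f be an edge through w
-- that avoids v.  Two edges through v that miss f would complete e and f to a
-- copy of B₄ʳ, and by linearity every other edge through v uses up a vertex of
-- f, so v has degree at most r + 1.  Hence all neighbours of a vertex of degree
-- at least r + 2 have degree 1.  Weight vertices of degree ≤ 1 by r, those of
-- degree ≥ r + 2 by 0 and all others by 1: every edge has weight at least r, and
-- every vertex has weight times degree at most r + 1, with equality only in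
-- degree r + 1.  Summing gives the bound.  In the extremal case H is
-- (r + 1)-regular, and counting in the first step leaves no vertex of f that is
-- not a neighbour of v; so adjacency is transitive, and its classes are the
-- Steiner systems.  Conversely, in S(2,r,r²) an edge f avoiding v meets r of the
-- r + 1 edges through v, and a copy of B₄ʳ would need two that miss it.

open import Defs
open import Data.Bool as Bool using (true; false; if_then_else_)
open import Data.Empty using (⊥)
open import Data.Fin as Fin using (Fin; zero; suc; #_; _↑ˡ_; _↑ʳ_; combine; remQuot; splitAt)
import Data.Fin.Properties as Fin
open import Data.Fin.Subset using (Subset; _∈_; _∉_; _⊆_; _∩_; _─_; ∣_∣; ⁅_⁆)
open import Data.Fin.Subset.Properties using
  ( _∈?_; _⊆?_; x∈⁅x⁆; x∈⁅y⁆⇒x≡y; ∣⁅x⁆∣≡1; ∣⊥∣≡0; Empty-unique; x∈p∩q⁺; x∈p∩q⁻; drop-∷-⊆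
  ; p⊆q⇒∣p∣≤∣q∣; p─q⊆p; x∈p∧x∉q⇒x∈p─q; ⊆-antisym )
open import Data.List as List using (List)
open import Data.List.Membership.Propositional.Properties using
  (∈-lookup; ∈-tabulate⁺; ∈-tabulate⁻; ∈-allFin; ∈-filter⁺; ∈-filter⁻)
open import Data.List.Membership.Setoid.Properties using (∈-deduplicate⁺)
import Data.List.Relation.Unary.All as All
open import Data.List.Relation.Unary.AllPairs using (AllPairs; _∷_)
open import Data.List.Relation.Unary.Any as Any using (Any; index)
open import Data.List.Relation.Unary.Any.Properties using (lookup-index)
open import Data.List.Relation.Unary.Unique.DecSetoid.Properties using (deduplicate-!)
open import Data.List.Relation.Unary.Unique.Propositional.Properties using (filter⁺)
open import Data.Nat using (ℕ; zero; suc; _+_; _*_; _∸_; _^_; _≤_; _<_; _≤?_; z≤n; s≤s)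
import Data.Nat.Properties as ℕ
open import Data.Nat.Tactic.RingSolver using (solve-∀)
open import Data.Product using (∃-syntax; Σ-syntax; _×_; _,_; proj₁; proj₂)
open import Data.Sum using ([_,_]′; inj₁; inj₂)
open import Data.Vec as Vec using ([]; _∷_; lookup; tabulate; here; there)
open import Data.Vec.Properties as Vec using ([]=⇒lookup; lookup⇒[]=)
open import Function using (_∘_; Injective; _$_; _⇔_; mk⇔; Equivalence)
open import Level using (0ℓ)
open import Relation.Binary.Bundles using (DecSetoid)
open import Relation.Binary.Definitions using (Symmetric; tri<; tri≈; tri>)
open import Relation.Binary.PropositionalEquality
open import Relation.Nullary using (¬_; Dec; yes; no; contradiction; does)
open import Relation.Nullary.Decidable using
  (_×-dec_; _→-dec_; ¬?; dec-true; decidable-stable; from-yes)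

open import Algebra.Properties.Semiring.Sum ℕ.+-*-semiring
  using (sum; sum-syntax; sum-cong-≗; ∑-comm; ∑-distrib-+; *-distribˡ-sum)

private
  variable
    k m n r : ℕ

-- Sums and finite sets

∑-mono : {a b : Fin n → ℕ} → (∀ i → a i ≤ b i) → sum a ≤ sum b
∑-mono {zero}  _   = z≤n
∑-mono {suc n} a≤b = ℕ.+-mono-≤ (a≤b zero) (∑-mono (a≤b ∘ suc))

-- Cancelling the inequality for all other terms from the reversed inequality between the totals
-- leaves the reverse inequality for one term. Every equality case below is extracted this way.
∑-tight : {a b : Fin n → ℕ} → (∀ i → a i ≤ b i) → sum b ≤ sum a → a ≗ b
∑-tight {suc n} {a} {b} a≤b ∑b≤∑a zero = ℕ.≤-antisym (a≤b zero)
  (ℕ.+-cancelʳ-≤ (sum (b ∘ suc)) _ _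
    (ℕ.≤-trans ∑b≤∑a (ℕ.+-monoʳ-≤ (a zero) (∑-mono (a≤b ∘ suc)))))
∑-tight {suc n} {a} {b} a≤b ∑b≤∑a (suc i) = ∑-tight (a≤b ∘ suc)
  (ℕ.+-cancelˡ-≤ (b zero) _ _
    (ℕ.≤-trans ∑b≤∑a (ℕ.+-monoˡ-≤ (sum (a ∘ suc)) (a≤b zero)))) i

∑-const : ∀ n c → ∑[ i < n ] c ≡ n * c
∑-const zero    c = refl
∑-const (suc n) c = cong (c +_) (∑-const n c)

term≤∑ : (a : Fin n → ℕ) (i : Fin n) → a i ≤ sum a
term≤∑ a zero    = ℕ.m≤m+n _ _
term≤∑ a (suc i) = ℕ.≤-trans (term≤∑ (a ∘ suc) i) (ℕ.m≤n+m _ (a zero))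

∑-positive : (a : Fin n → ℕ) → 1 ≤ sum a → ∃[ i ] 1 ≤ a i
∑-positive {suc n} a 1≤∑ with a zero in eq
... | suc _ = zero , ℕ.≤-trans (s≤s z≤n) (ℕ.≤-reflexive (sym eq))
... | zero  = let i , p = ∑-positive (a ∘ suc) 1≤∑ in suc i , p

-- Turns "at most one" into a numerical bound. Linearity and the absence of a configuration enter
-- the counts through it.
∑≤1 : {a : Fin n → ℕ} → (∀ i → a i ≤ 1) → (∀ i j → 1 ≤ a i → 1 ≤ a j → i ≡ j) → sum a ≤ 1
∑≤1 {zero}      _   _      = z≤n
∑≤1 {suc n} {a} a≤1 unique with a zero in eq
... | zero  = ∑≤1 (a≤1 ∘ suc) λ i j p q → Fin.suc-injective (unique (suc i) (suc j) p q)
... | suc k = subst (λ s → suc k + s ≤ 1) (sym rest)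
                (subst (_≤ 1) (trans eq (sym (ℕ.+-identityʳ (suc k)))) (a≤1 zero))
  where
  rest : sum (a ∘ suc) ≡ 0
  rest with sum (a ∘ suc) in s
  ... | zero  = refl
  ... | suc _ with i , p ← ∑-positive (a ∘ suc) (subst (1 ≤_) (sym s) (s≤s z≤n)) =
    contradiction (unique zero (suc i) (subst (1 ≤_) (sym eq) (s≤s z≤n)) p) λ ()

-- The indicator function takes values in `ℕ`, so that sizes, degrees and codegrees are all sums and
-- double counting is an exchange of summations.
mem : Subset n → Fin n → ℕ
mem p x = if lookup p x then 1 else 0

mem-∈ : {p : Subset n} {x : Fin n} → x ∈ p → mem p x ≡ 1
mem-∈ x∈p = cong (λ b → if b then 1 else 0) ([]=⇒lookup x∈p)

mem-positive : {p : Subset n} {x : Fin n} → 1 ≤ mem p x → x ∈ p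
mem-positive {p = p} {x} 1≤ with lookup p x in eq
... | true  = lookup⇒[]= x p eq
mem-positive () | false

mem-∉ : {p : Subset n} {x : Fin n} → x ∉ p → mem p x ≡ 0
mem-∉ {p = p} {x} x∉p with lookup p x in eq
... | true  = contradiction (lookup⇒[]= x p eq) x∉p
... | false = refl

mem≤1 : (p : Subset n) (x : Fin n) → mem p x ≤ 1
mem≤1 p x with lookup p x
... | true  = s≤s z≤n
... | false = z≤n

mem-∩ : (p q : Subset n) (x : Fin n) → mem (p ∩ q) x ≡ mem p x * mem q x
mem-∩ p q x rewrite Vec.lookup-zipWith Bool._∧_ x p q with lookup p x | lookup q x
... | true  | true  = refl
... | true  | false = refl
... | false | _     = refl

∣∣≡∑ : (p : Subset n) → ∣ p ∣ ≡ sum (mem p)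
∣∣≡∑ []          = refl
∣∣≡∑ (true  ∷ p) = cong suc (∣∣≡∑ p)
∣∣≡∑ (false ∷ p) = ∣∣≡∑ p

∣p∣≤1 : (p : Subset n) → (∀ x y → x ∈ p → y ∈ p → x ≡ y) → ∣ p ∣ ≤ 1
∣p∣≤1 p unique = subst (_≤ 1) (sym (∣∣≡∑ p))
  (∑≤1 (mem≤1 p) λ x y p q → unique x y (mem-positive p) (mem-positive q))

enumerate : (p : Subset n) → Fin ∣ p ∣ → Fin n
enumerate (true  ∷ p) zero    = zero
enumerate (true  ∷ p) (suc i) = suc (enumerate p i)
enumerate (false ∷ p) i       = suc (enumerate p i)

enumerate-∈ : (p : Subset n) (i : Fin ∣ p ∣) → enumerate p i ∈ p
enumerate-∈ (true  ∷ p) zero    = here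
enumerate-∈ (true  ∷ p) (suc i) = there (enumerate-∈ p i)
enumerate-∈ (false ∷ p) i       = there (enumerate-∈ p i)

enumerate-injective : (p : Subset n) → Injective _≡_ _≡_ (enumerate p)
enumerate-injective (true  ∷ p) {zero}  {zero}  _  = refl
enumerate-injective (true  ∷ p) {suc i} {suc j} eq =
  cong suc (enumerate-injective p (Fin.suc-injective eq))
enumerate-injective (false ∷ p) eq = enumerate-injective p (Fin.suc-injective eq)

enumerate-surjective : (p : Subset n) {x : Fin n} → x ∈ p → ∃[ i ] enumerate p i ≡ x
enumerate-surjective (true  ∷ p) here      = zero , refl
enumerate-surjective (true  ∷ p) (there q) =
  let i , eq = enumerate-surjective p q in suc i , cong suc eq
enumerate-surjective (false ∷ p) (there q) =
  let i , eq = enumerate-surjective p q in i , cong suc eq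

∣p∣≤1⇒≡ : {p : Subset n} → ∣ p ∣ ≤ 1 → ∀ {x y} → x ∈ p → y ∈ p → x ≡ y
∣p∣≤1⇒≡ {p = p} ∣p∣≤1 x∈p y∈p
  with i , refl ← enumerate-surjective p x∈p | j , refl ← enumerate-surjective p y∈p =
  cong (enumerate p) (only ∣p∣≤1 i j)
  where
  only : ∀ {k} → k ≤ 1 → (i j : Fin k) → i ≡ j
  only (s≤s z≤n) zero zero = refl

another-element : {p : Subset n} → 2 ≤ ∣ p ∣ → ∀ x → ∃[ y ] y ∈ p × y ≢ x
another-element {p = p} 2≤∣p∣ x with Fin.any? (λ y → (y ∈? p) ×-dec ¬? (y Fin.≟ x))
... | yes found = found
... | no  none  = contradiction
  (ℕ.≤-trans 2≤∣p∣ (∣p∣≤1 p λ y z y∈p z∈p → trans (≡x y∈p) (sym (≡x z∈p)))) λ { (s≤s ()) }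
  where
  ≡x : ∀ {y} → y ∈ p → y ≡ x
  ≡x {y} y∈p with y Fin.≟ x
  ... | yes eq = eq
  ... | no  ne = contradiction (y , y∈p , ne) none

-- The size is freed to an arbitrary `k` because the groups of new vertices of an expansion are
-- indexed by `Fin (r ∸ 2)`.
enumeration : (p : Subset n) → ∣ p ∣ ≡ k →
  Σ[ f ∈ (Fin k → Fin n) ] Injective _≡_ _≡_ f × (∀ i → f i ∈ p) × (∀ {x} → x ∈ p → ∃[ i ] f i ≡ x)
enumeration p refl = enumerate p , enumerate-injective p , enumerate-∈ p , enumerate-surjective p

-- Copies of expansions

∈-image⁺ : (f : Fin m → Fin n) {e : Subset m} {x : Fin m} → x ∈ e → f x ∈ image f e
∈-image⁺ f {e} {x} x∈e = lookup⇒[]= (f x) _ $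
  trans (Vec.lookup∘tabulate _ (f x))
    (dec-true (Fin.any? λ z → (z ∈? e) ×-dec (f z Fin.≟ f x)) (x , x∈e , refl))

∈-image⁻ : (f : Fin m → Fin n) {e : Subset m} {y : Fin n} → y ∈ image f e → ∃[ x ] x ∈ e × f x ≡ y
∈-image⁻ f {e} {y} y∈ with Fin.any? (λ x → (x ∈? e) ×-dec (f x Fin.≟ y))
                          | trans (sym (Vec.lookup∘tabulate _ y)) ([]=⇒lookup y∈)
... | yes found | _ = found

∣image∣ : {f : Fin m → Fin n} → Injective _≡_ _≡_ f → ∀ e → ∣ image f e ∣ ≡ ∣ e ∣
∣image∣ {f = f} inj e = ℕ.≤-antisym
  (Fin.injective⇒≤ {f = λ i → proj₁ (pre i)} λ {i} {j} eq →
    enumerate-injective (image f e) (trans (sym (proj₂ (pre i)))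
      (trans (cong (f ∘ enumerate e) eq) (proj₂ (pre j)))))
  (Fin.injective⇒≤ {f = λ i → proj₁ (post i)} λ {i} {j} eq →
    enumerate-injective e (inj (trans (sym (proj₂ (post i)))
      (trans (cong (enumerate (image f e)) eq) (proj₂ (post j))))))
  where
  pre : ∀ i → ∃[ j ] f (enumerate e j) ≡ enumerate (image f e) i
  pre i with x , x∈e , eq ← ∈-image⁻ f (enumerate-∈ (image f e) i)
        with j , refl ← enumerate-surjective e x∈e = j , eq

  post : ∀ i → ∃[ j ] enumerate (image f e) j ≡ f (enumerate e i)
  post i = enumerate-surjective (image f e) (∈-image⁺ f (enumerate-∈ e i))

∣p─q∣ : {p q : Subset n} → q ⊆ p → ∣ p ─ q ∣ ≡ ∣ p ∣ ∸ ∣ q ∣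
∣p─q∣ {p = p} {q} q⊆p = ℕ.+-cancelʳ-≡ _ _ _ (trans (go p q q⊆p) (sym (ℕ.m∸n+n≡m (p⊆q⇒∣p∣≤∣q∣ q⊆p))))
  where
  go : ∀ {n} (p q : Subset n) → q ⊆ p → ∣ p ─ q ∣ + ∣ q ∣ ≡ ∣ p ∣
  go []          []          _   = refl
  go (true  ∷ p) (true  ∷ q) q⊆p = trans (ℕ.+-suc _ _) (cong suc (go p q (drop-∷-⊆ q⊆p)))
  go (true  ∷ p) (false ∷ q) q⊆p = cong suc (go p q (drop-∷-⊆ q⊆p))
  go (false ∷ p) (true  ∷ q) q⊆p = contradiction (q⊆p here) λ ()
  go (false ∷ p) (false ∷ q) q⊆p = go p q (drop-∷-⊆ q⊆p)

x∈p─q⁻ : (p q : Subset n) {x : Fin n} → x ∈ p ─ q → x ∉ q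
x∈p─q⁻ (_ ∷ p) (false ∷ q) (there x∈) (there x∈q) = x∈p─q⁻ p q x∈ x∈q
x∈p─q⁻ (_ ∷ p) (true  ∷ q) (there x∈) (there x∈q) = x∈p─q⁻ p q x∈ x∈q

module Expansion {p : ℕ} (r : ℕ) (G : Hypergraph p) where

  edgeG : Fin (size G) → Subset p
  edgeG = List.lookup (edges G)

  old : Fin p → Fin (p + size G * (r ∸ 2))
  old a = a ↑ˡ _

  new : Fin (size G) → Fin (r ∸ 2) → Fin (p + size G * (r ∸ 2))
  new i k = p ↑ʳ combine i k

  -- A view of the vertex set: matching on it separates old from new vertices without unfolding
  -- `splitAt` and `remQuot`.
  data Vertex : Fin (p + size G * (r ∸ 2)) → Set where
    is-old : ∀ a → Vertex (old a)
    is-new : ∀ i k → Vertex (new i k)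

  vertex : ∀ x → Vertex x
  vertex x with splitAt p x in eq
  ... | inj₁ a = subst Vertex (Fin.splitAt⁻¹-↑ˡ eq) (is-old a)
  ... | inj₂ z with i , k , refl ← Fin.combine-surjective {size G} {r ∸ 2} z =
    subst Vertex (Fin.splitAt⁻¹-↑ʳ eq) (is-new i k)

  lookup-old : ∀ i a → lookup (expandedEdge r G i) (old a) ≡ lookup (edgeG i) a
  lookup-old i a = Vec.lookup-++ˡ (edgeG i) _ a

  lookup-new : ∀ i j k → lookup (expandedEdge r G i) (new j k) ≡ lookup ⁅ i ⁆ j
  lookup-new i j k = begin
    lookup (expandedEdge r G i) (new j k)           ≡⟨ Vec.lookup-++ʳ (edgeG i) _ _ ⟩
    lookup (Vec.concat groups) (combine j k)        ≡⟨ Vec.lookup-concat groups j k ⟩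
    lookup (lookup groups j) k
      ≡⟨ cong (λ v → lookup v k) (Vec.lookup-map j (Vec.replicate _) ⁅ i ⁆) ⟩
    lookup (Vec.replicate (r ∸ 2) (lookup ⁅ i ⁆ j)) k ≡⟨ Vec.lookup-replicate k _ ⟩
    lookup ⁅ i ⁆ j                                  ∎
    where
    open ≡-Reasoning
    groups = Vec.map (Vec.replicate (r ∸ 2)) ⁅ i ⁆

  old∈⁺ : ∀ {i a} → a ∈ edgeG i → old a ∈ expandedEdge r G i
  old∈⁺ {i} {a} a∈ = lookup⇒[]= _ _ (trans (lookup-old i a) ([]=⇒lookup a∈))

  old∈⁻ : ∀ {i a} → old a ∈ expandedEdge r G i → a ∈ edgeG i
  old∈⁻ {i} {a} a∈ = lookup⇒[]= _ _ (trans (sym (lookup-old i a)) ([]=⇒lookup a∈))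

  new∈⁺ : ∀ {i k} → new i k ∈ expandedEdge r G i
  new∈⁺ {i} {k} = lookup⇒[]= _ _ (trans (lookup-new i i k) ([]=⇒lookup (x∈⁅x⁆ i)))

  new∈⁻ : ∀ {i j k} → new j k ∈ expandedEdge r G i → j ≡ i
  new∈⁻ {i} {j} {k} k∈ = x∈⁅y⁆⇒x≡y i
    (lookup⇒[]= j _ (trans (sym (lookup-new i j k)) ([]=⇒lookup k∈)))

  expandedEdge∈ : ∀ i → expandedEdge r G i ∈ᴱ expansion r G
  expandedEdge∈ i = ∈-tabulate⁺ i

  -- A copy of the expansion needs only images for the vertices of `G` and edges with the right
  -- incidences that meet nowhere else. Each chosen edge then has exactly `r ∸ 2` further vertices,
  -- shared with no other chosen edge, and these receive its group of new vertices.
  module _ (graph : Uniform 2 G) {n : ℕ} (H : Hypergraph n) (uniform : Uniform r H)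
    (h : Fin p → Fin n) (h-injective : Injective _≡_ _≡_ h)
    (E : Fin (size G) → Subset n) (E∈H : ∀ i → E i ∈ᴱ H)
    (incidence : ∀ i a → lookup (E i) (h a) ≡ lookup (edgeG i) a)
    (meet : ∀ {i j} → i ≢ j → ∀ {y} → y ∈ E i → y ∈ E j → ∃[ a ] h a ≡ y)
    where

    private
      h∈⁺ : ∀ {i a} → a ∈ edgeG i → h a ∈ E i
      h∈⁺ {i} {a} a∈ = lookup⇒[]= _ _ (trans (incidence i a) ([]=⇒lookup a∈))

      h∈⁻ : ∀ {i a} → h a ∈ E i → a ∈ edgeG i
      h∈⁻ {i} {a} a∈ = lookup⇒[]= _ _ (trans (sym (incidence i a)) ([]=⇒lookup a∈))

      rest : Fin (size G) → Subset n
      rest i = E i ─ image h (edgeG i)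

      image⊆ : ∀ i → image h (edgeG i) ⊆ E i
      image⊆ i y∈ with a , a∈ , refl ← ∈-image⁻ h y∈ = h∈⁺ a∈

      ∣rest∣ : ∀ i → ∣ rest i ∣ ≡ r ∸ 2
      ∣rest∣ i = trans (∣p─q∣ (image⊆ i)) (cong₂ _∸_ (uniform _ (E∈H i))
        (trans (∣image∣ h-injective (edgeG i)) (graph _ (∈-lookup i))))

      rest⊆ : ∀ {i} → rest i ⊆ E i
      rest⊆ {i} = p─q⊆p (E i) _

      h∉rest : ∀ {i a} → h a ∉ rest i
      h∉rest {i} h∈ = x∈p─q⁻ (E i) _ h∈ (∈-image⁺ h (h∈⁻ (rest⊆ h∈)))

      extra : Fin (size G) → Fin (r ∸ 2) → Fin n
      extra i = proj₁ (enumeration (rest i) (∣rest∣ i))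

      extra-injective : ∀ i → Injective _≡_ _≡_ (extra i)
      extra-injective i = proj₁ (proj₂ (enumeration (rest i) (∣rest∣ i)))

      extra∈ : ∀ i k → extra i k ∈ rest i
      extra∈ i = proj₁ (proj₂ (proj₂ (enumeration (rest i) (∣rest∣ i))))

      extra-surjective : ∀ i {x} → x ∈ rest i → ∃[ k ] extra i k ≡ x
      extra-surjective i = proj₂ (proj₂ (proj₂ (enumeration (rest i) (∣rest∣ i))))

      φ : Fin (p + size G * (r ∸ 2)) → Fin n
      φ x = [ h , (λ z → let i , k = remQuot (r ∸ 2) z in extra i k) ]′ (splitAt p x)

      φ-old : ∀ a → φ (old a) ≡ h a
      φ-old a = cong [ h , _ ]′ (Fin.splitAt-↑ˡ p a _)

      φ-new : ∀ i k → φ (new i k) ≡ extra i k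
      φ-new i k = trans (cong [ h , _ ]′ (Fin.splitAt-↑ʳ p _ (combine i k)))
        (cong (λ ik → extra (proj₁ ik) (proj₂ ik)) (Fin.remQuot-combine i k))

      -- By `meet` a common vertex would be the image of an old vertex, and `rest i` contains no
      -- such image.
      extra-disjoint : ∀ {i j k l} → i ≢ j → extra i k ≢ extra j l
      extra-disjoint {i} {j} {k} {l} i≢j eq =
        h∉rest (subst (_∈ rest i) (sym (proj₂ common)) (extra∈ i k))
        where
        common : ∃[ a ] h a ≡ extra i k
        common = meet i≢j (rest⊆ (extra∈ i k)) (subst (_∈ E j) (sym eq) (rest⊆ (extra∈ j l)))

      extra≡⇒≡ : ∀ i j {k l} → extra i k ≡ extra j l → new i k ≡ new j l
      extra≡⇒≡ i j eq = same (decidable-stable (i Fin.≟ j) λ i≢j → extra-disjoint i≢j eq) eq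
        where
        same : ∀ {i j k l} → i ≡ j → extra i k ≡ extra j l → new i k ≡ new j l
        same {i} refl eq = cong (new i) (extra-injective i eq)

      φ-injective : Injective _≡_ _≡_ φ
      φ-injective {x} {y} = go (vertex x) (vertex y)
        where
        go : ∀ {x y} → Vertex x → Vertex y → φ x ≡ φ y → x ≡ y
        go (is-old a)   (is-old b)   eq =
          cong (_↑ˡ _) (h-injective (trans (sym (φ-old a)) (trans eq (φ-old b))))
        go (is-old a)   (is-new j l) eq = contradiction
          (subst (_∈ rest j) (trans (sym (φ-new j l)) (trans (sym eq) (φ-old a))) (extra∈ j l)) h∉rest
        go (is-new i k) (is-old b)   eq = contradiction
          (subst (_∈ rest i) (trans (sym (φ-new i k)) (trans eq (φ-old b))) (extra∈ i k)) h∉rest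
        go (is-new i k) (is-new j l) eq =
          extra≡⇒≡ i j (trans (sym (φ-new i k)) (trans eq (φ-new j l)))

      image-expandedEdge : ∀ i → image φ (expandedEdge r G i) ≡ E i
      image-expandedEdge i = ⊆-antisym to from
        where
        φ∈ : ∀ {x} → Vertex x → x ∈ expandedEdge r G i → φ x ∈ E i
        φ∈ (is-old a)   x∈ = subst (_∈ E i) (sym (φ-old a)) (h∈⁺ (old∈⁻ x∈))
        φ∈ (is-new j k) x∈ = subst (λ i → φ (new j k) ∈ E i) (new∈⁻ x∈)
          (subst (_∈ E j) (sym (φ-new j k)) (rest⊆ (extra∈ j k)))

        to : image φ (expandedEdge r G i) ⊆ E i
        to y∈ = let x , x∈ , eq = ∈-image⁻ φ y∈ in subst (_∈ E i) eq (φ∈ (vertex x) x∈)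

        from : E i ⊆ image φ (expandedEdge r G i)
        from {y} y∈ = go (y ∈? image h (edgeG i))
          where
          go : Dec (y ∈ image h (edgeG i)) → y ∈ image φ (expandedEdge r G i)
          go (yes y∈h) =
            let a , a∈ , eq = ∈-image⁻ h y∈h in
            subst (_∈ _) (trans (φ-old a) eq) (∈-image⁺ φ (old∈⁺ a∈))
          go (no y∉h) =
            let k , eq = extra-surjective i (x∈p∧x∉q⇒x∈p─q y∈ y∉h) in
            subst (_∈ _) (trans (φ-new i k) eq) (∈-image⁺ φ (new∈⁺ {i} {k}))

    contains-expansion : Contains H (expansion r G)
    contains-expansion = φ , φ-injective , λ e e∈ →
      let i , e≡ = ∈-tabulate⁻ e∈ in
      subst (_∈ᴱ H) (sym (trans (cong (image φ) e≡) (image-expandedEdge i))) (E∈H i)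

-- Copies of the expansion of `B₄` as configurations of four edges

∉⇒lookup : {p : Subset n} {x : Fin n} → x ∉ p → lookup p x ≡ false
∉⇒lookup {p = p} {x} x∉p with lookup p x in eq
... | true  = contradiction (lookup⇒[]= x p eq) x∉p
... | false = refl

Disjoint : Subset n → Subset n → Set
Disjoint p q = ∀ {x} → x ∈ p → x ∉ q

linear-meet : {H : Hypergraph n} → Linear H → ∀ {e f} → e ∈ᴱ H → f ∈ᴱ H → e ≢ f →
              ∀ {x y} → x ∈ e → x ∈ f → y ∈ e → y ∈ f → x ≡ y
linear-meet linear e∈H f∈H e≢f x∈e x∈f y∈e y∈f =
  ∣p∣≤1⇒≡ (linear _ _ e∈H f∈H e≢f) (x∈p∩q⁺ (x∈e , x∈f)) (x∈p∩q⁺ (y∈e , y∈f))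

-- The part of a copy of B₄ʳ that linearity does not supply. The edges `g₁`, `g₂` and `e` meet only
-- in `v` once they are distinct; `g₁` and `g₂` differ from `e` since they avoid `w`, and `e`
-- differs from `f` since `f` avoids `v`.
record B₄-Configuration (H : Hypergraph n) : Set where
  field
    {v w}           : Fin n
    {g₁ g₂ e f}     : Subset n
    g₁∈H            : g₁ ∈ᴱ H
    g₂∈H            : g₂ ∈ᴱ H
    e∈H             : e ∈ᴱ H
    f∈H             : f ∈ᴱ H
    v∈g₁            : v ∈ g₁
    v∈g₂            : v ∈ g₂
    v∈e             : v ∈ e
    w∈e             : w ∈ e
    w∈f             : w ∈ f
    v∉f             : v ∉ f
    g₁≢g₂           : g₁ ≢ g₂
    g₁∥f            : Disjoint g₁ f
    g₂∥f            : Disjoint g₂ f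

edgeB₄ : Fin 4 → Subset 5
edgeB₄ = List.lookup (edges B₄)

-- A vertex of `B₄` is determined by the edges through it, so a map that respects incidences is
-- automatically injective.
edgesB₄-separate : ∀ x y → (∀ i → lookup (edgeB₄ i) x ≡ lookup (edgeB₄ i) y) → x ≡ y
edgesB₄-separate = from-yes (Fin.all? λ x → Fin.all? λ y →
  Fin.all? (λ i → lookup (edgeB₄ i) x Bool.≟ lookup (edgeB₄ i) y) →-dec (x Fin.≟ y))

module _ {n r : ℕ} {H : Hypergraph n} (2≤r : 2 ≤ r) (uniform : Uniform r H) (linear : Linear H)
  (config : B₄-Configuration H) where

  open B₄-Configuration config

  private
    second : ∀ {e} → e ∈ᴱ H → ∀ x → ∃[ y ] y ∈ e × y ≢ x
    second e∈H = another-element (subst (2 ≤_) (sym (uniform _ e∈H)) 2≤r)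

    -- Images of the three leaves of `B₄`: any second vertex on `g₁`, `g₂` and `f` will do.
    a b c : Fin n
    a = proj₁ (second g₁∈H v)
    b = proj₁ (second g₂∈H v)
    c = proj₁ (second f∈H w)

    a∈g₁ : a ∈ g₁
    a∈g₁ = proj₁ (proj₂ (second g₁∈H v))

    b∈g₂ : b ∈ g₂
    b∈g₂ = proj₁ (proj₂ (second g₂∈H v))

    c∈f : c ∈ f
    c∈f = proj₁ (proj₂ (second f∈H w))

    a≢v : a ≢ v
    a≢v = proj₂ (proj₂ (second g₁∈H v))

    b≢v : b ≢ v
    b≢v = proj₂ (proj₂ (second g₂∈H v))

    c≢w : c ≢ w
    c≢w = proj₂ (proj₂ (second f∈H w))

    g₁≢e : g₁ ≢ e
    g₁≢e g₁≡e = g₁∥f (subst (w ∈_) (sym g₁≡e) w∈e) w∈f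

    g₂≢e : g₂ ≢ e
    g₂≢e g₂≡e = g₂∥f (subst (w ∈_) (sym g₂≡e) w∈e) w∈f

    e≢f : e ≢ f
    e≢f e≡f = v∉f (subst (v ∈_) e≡f v∈e)

    meet-g₁g₂ : ∀ {x} → x ∈ g₁ → x ∈ g₂ → x ≡ v
    meet-g₁g₂ x∈ x∈′ = linear-meet {H = H} linear g₁∈H g₂∈H g₁≢g₂ x∈ x∈′ v∈g₁ v∈g₂

    meet-g₁e : ∀ {x} → x ∈ g₁ → x ∈ e → x ≡ v
    meet-g₁e x∈ x∈′ = linear-meet {H = H} linear g₁∈H e∈H g₁≢e x∈ x∈′ v∈g₁ v∈e

    meet-g₂e : ∀ {x} → x ∈ g₂ → x ∈ e → x ≡ v
    meet-g₂e x∈ x∈′ = linear-meet {H = H} linear g₂∈H e∈H g₂≢e x∈ x∈′ v∈g₂ v∈e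

    meet-ef : ∀ {x} → x ∈ e → x ∈ f → x ≡ w
    meet-ef x∈ x∈′ = linear-meet {H = H} linear e∈H f∈H e≢f x∈ x∈′ w∈e w∈f

    E : Fin 4 → Subset n
    E = lookup (g₁ ∷ g₂ ∷ e ∷ f ∷ [])

    h : Fin 5 → Fin n
    h = lookup (v ∷ a ∷ b ∷ w ∷ c ∷ [])

    E∈H : ∀ i → E i ∈ᴱ H
    E∈H zero                   = g₁∈H
    E∈H (suc zero)             = g₂∈H
    E∈H (suc (suc zero))       = e∈H
    E∈H (suc (suc (suc zero))) = f∈H

    incidence : ∀ i x → lookup (E i) (h x) ≡ lookup (edgeB₄ i) x
    incidence zero zero = []=⇒lookup v∈g₁
    incidence zero (suc zero) = []=⇒lookup a∈g₁
    incidence zero (suc (suc zero)) = ∉⇒lookup λ b∈ → b≢v (meet-g₁g₂ b∈ b∈g₂)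
    incidence zero (suc (suc (suc zero))) = ∉⇒lookup λ w∈ → g₁∥f w∈ w∈f
    incidence zero (suc (suc (suc (suc zero)))) = ∉⇒lookup λ c∈ → g₁∥f c∈ c∈f
    incidence (suc zero) zero = []=⇒lookup v∈g₂
    incidence (suc zero) (suc zero) = ∉⇒lookup λ a∈ → a≢v (meet-g₁g₂ a∈g₁ a∈)
    incidence (suc zero) (suc (suc zero)) = []=⇒lookup b∈g₂
    incidence (suc zero) (suc (suc (suc zero))) = ∉⇒lookup λ w∈ → g₂∥f w∈ w∈f
    incidence (suc zero) (suc (suc (suc (suc zero)))) = ∉⇒lookup λ c∈ → g₂∥f c∈ c∈f
    incidence (suc (suc zero)) zero = []=⇒lookup v∈e
    incidence (suc (suc zero)) (suc zero) = ∉⇒lookup λ a∈ → a≢v (meet-g₁e a∈g₁ a∈)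
    incidence (suc (suc zero)) (suc (suc zero)) = ∉⇒lookup λ b∈ → b≢v (meet-g₂e b∈g₂ b∈)
    incidence (suc (suc zero)) (suc (suc (suc zero))) = []=⇒lookup w∈e
    incidence (suc (suc zero)) (suc (suc (suc (suc zero)))) = ∉⇒lookup λ c∈ → c≢w (meet-ef c∈ c∈f)
    incidence (suc (suc (suc zero))) zero = ∉⇒lookup v∉f
    incidence (suc (suc (suc zero))) (suc zero) = ∉⇒lookup (g₁∥f a∈g₁)
    incidence (suc (suc (suc zero))) (suc (suc zero)) = ∉⇒lookup (g₂∥f b∈g₂)
    incidence (suc (suc (suc zero))) (suc (suc (suc zero))) = []=⇒lookup w∈f
    incidence (suc (suc (suc zero))) (suc (suc (suc (suc zero)))) = []=⇒lookup c∈f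

    h-injective : Injective _≡_ _≡_ h
    h-injective {x} {y} eq = edgesB₄-separate x y λ i →
      trans (sym (incidence i x)) (trans (cong (lookup (E i)) eq) (incidence i y))

    -- Vertex 0 of `B₄`, sent to `v`, is the meeting point of the three edges at the centre; vertex
    -- 3, sent to `w`, is that of `e` and `f`. Symmetry covers the pairs in decreasing order.
    meet< : ∀ i j → i Fin.< j → ∀ {y} → y ∈ E i → y ∈ E j → ∃[ x ] h x ≡ y
    meet< zero (suc zero) _ y∈ y∈′ = # 0 , sym (meet-g₁g₂ y∈ y∈′)
    meet< zero (suc (suc zero)) _ y∈ y∈′ = # 0 , sym (meet-g₁e y∈ y∈′)
    meet< zero (suc (suc (suc zero))) _ y∈ y∈′ = contradiction y∈′ (g₁∥f y∈)
    meet< (suc zero) (suc (suc zero)) _ y∈ y∈′ = # 0 , sym (meet-g₂e y∈ y∈′)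
    meet< (suc zero) (suc (suc (suc zero))) _ y∈ y∈′ = contradiction y∈′ (g₂∥f y∈)
    meet< (suc (suc zero)) (suc (suc (suc zero))) _ y∈ y∈′ = # 3 , sym (meet-ef y∈ y∈′)
    meet< (suc zero) (suc zero) (s≤s ())
    meet< (suc (suc zero)) (suc zero) (s≤s ())
    meet< (suc (suc zero)) (suc (suc zero)) (s≤s (s≤s ()))
    meet< (suc (suc (suc zero))) (suc zero) (s≤s ())
    meet< (suc (suc (suc zero))) (suc (suc zero)) (s≤s (s≤s ()))
    meet< (suc (suc (suc zero))) (suc (suc (suc zero))) (s≤s (s≤s (s≤s ())))

    meet : ∀ {i j} → i ≢ j → ∀ {y} → y ∈ E i → y ∈ E j → ∃[ x ] h x ≡ y
    meet {i} {j} i≢j y∈ y∈′ with Fin.<-cmp i j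
    ... | tri< i<j _ _ = meet< i j i<j y∈ y∈′
    ... | tri≈ _ i≡j _ = contradiction i≡j i≢j
    ... | tri> _ _ j<i = meet< j i j<i y∈′ y∈

  configuration⇒contains : Contains H (expansion r B₄)
  configuration⇒contains =
    Expansion.contains-expansion r B₄ B₄-isGraph H uniform h h-injective E E∈H incidence meet

contains⇒configuration : {H : Hypergraph n} → Contains H (expansion r B₄) → B₄-Configuration H
contains⇒configuration {n = n} {r = r} {H = H} (φ , φ-injective , φ-edge) = record
  { g₁∈H  = E∈H (# 0)
  ; g₂∈H  = E∈H (# 1)
  ; e∈H   = E∈H (# 2)
  ; f∈H   = E∈H (# 3)
  ; v∈g₁  = φold∈⁺ (# 0) (from-yes (# 0 ∈? edgeB₄ (# 0)))
  ; v∈g₂  = φold∈⁺ (# 1) (from-yes (# 0 ∈? edgeB₄ (# 1)))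
  ; v∈e   = φold∈⁺ (# 2) (from-yes (# 0 ∈? edgeB₄ (# 2)))
  ; w∈e   = φold∈⁺ (# 2) (from-yes (# 3 ∈? edgeB₄ (# 2)))
  ; w∈f   = φold∈⁺ (# 3) (from-yes (# 3 ∈? edgeB₄ (# 3)))
  ; v∉f   = λ v∈f → from-yes (¬? (# 0 ∈? edgeB₄ (# 3))) (φold∈⁻ (# 3) v∈f)
  -- Vertex 1 of `B₄` lies on its first edge but not on its second.
  ; g₁≢g₂ = λ g₁≡g₂ → from-yes (¬? (# 1 ∈? edgeB₄ (# 1))) (φold∈⁻ (# 1)
      (subst (φ (old (# 1)) ∈_) g₁≡g₂ (φold∈⁺ (# 0) (from-yes (# 1 ∈? edgeB₄ (# 0))))))
  ; g₁∥f  = disjoint (# 0) (# 3) (λ ())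
      (from-yes (Fin.all? λ a → ¬? ((a ∈? edgeB₄ (# 0)) ×-dec (a ∈? edgeB₄ (# 3)))))
  ; g₂∥f  = disjoint (# 1) (# 3) (λ ())
      (from-yes (Fin.all? λ a → ¬? ((a ∈? edgeB₄ (# 1)) ×-dec (a ∈? edgeB₄ (# 3)))))
  }
  where
  open Expansion r B₄

  E : Fin 4 → Subset n
  E i = image φ (expandedEdge r B₄ i)

  E∈H : ∀ i → E i ∈ᴱ H
  E∈H i = φ-edge _ (expandedEdge∈ i)

  φ∈⁻ : ∀ i {x} → φ x ∈ E i → x ∈ expandedEdge r B₄ i
  φ∈⁻ i φx∈ = let _ , z∈ , eq = ∈-image⁻ φ φx∈ in subst (_∈ expandedEdge r B₄ i) (φ-injective eq) z∈

  φold∈⁺ : ∀ i {a} → a ∈ edgeB₄ i → φ (old a) ∈ E i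
  φold∈⁺ i a∈ = ∈-image⁺ φ (old∈⁺ {i} a∈)

  φold∈⁻ : ∀ i {a} → φ (old a) ∈ E i → a ∈ edgeB₄ i
  φold∈⁻ i φa∈ = old∈⁻ {i} (φ∈⁻ i φa∈)

  -- A common vertex would be the image of an old one, lying on both edges of `B₄`, or of a new one,
  -- which lies on a single expanded edge.
  disjoint : ∀ i j → i ≢ j → (∀ a → ¬ (a ∈ edgeB₄ i × a ∈ edgeB₄ j)) → Disjoint (E i) (E j)
  disjoint i j i≢j apart {y} y∈i y∈j =
    let x , x∈i , eq = ∈-image⁻ φ y∈i in
    go (vertex x) x∈i (φ∈⁻ j (subst (_∈ E j) (sym eq) y∈j))
    where
    go : ∀ {x} → Vertex x → x ∈ expandedEdge r B₄ i → x ∉ expandedEdge r B₄ j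
    go (is-old a)   x∈i x∈j = apart a (old∈⁻ {i} x∈i , old∈⁻ {j} x∈j)
    go (is-new k l) x∈i x∈j = i≢j (trans (sym (new∈⁻ {i} {k} {l} x∈i)) (new∈⁻ {j} {k} {l} x∈j))

-- Degrees and codegrees

AllPairs-lookup : {A : Set} {R : A → A → Set} → Symmetric R → ∀ {xs} → AllPairs R xs →
                  ∀ {i j} → i ≢ j → R (List.lookup xs i) (List.lookup xs j)
AllPairs-lookup sym-R (_  ∷ _)   {zero}  {zero}  i≢j = contradiction refl i≢j
AllPairs-lookup sym-R (rs ∷ _)   {zero}  {suc j} i≢j = All.lookup rs (∈-lookup j)
AllPairs-lookup sym-R (rs ∷ _)   {suc i} {zero}  i≢j = sym-R (All.lookup rs (∈-lookup i))
AllPairs-lookup sym-R (_  ∷ rss) {suc i} {suc j} i≢j = AllPairs-lookup sym-R rss (i≢j ∘ cong suc)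

∑-⁅⁆ : (v : Fin n) → sum (mem ⁅ v ⁆) ≡ 1
∑-⁅⁆ v = trans (sym (∣∣≡∑ ⁅ v ⁆)) (∣⁅x⁆∣≡1 v)

mem-⁅⁆≢ : {v x : Fin n} → x ≢ v → mem ⁅ v ⁆ x ≡ 0
mem-⁅⁆≢ {v = v} {x} x≢v = mem-∉ λ x∈ → x≢v (x∈⁅y⁆⇒x≡y v x∈)

mem-idem : (p : Subset n) (x : Fin n) → mem p x * mem p x ≡ mem p x
mem-idem p x with lookup p x
... | true  = refl
... | false = refl

*-positive : ∀ a b → 1 ≤ a * b → 1 ≤ a × 1 ≤ b
*-positive (suc a) (suc b) _   = s≤s z≤n , s≤s z≤n
*-positive (suc a) zero    1≤ = contradiction (subst (1 ≤_) (ℕ.*-zeroʳ (suc a)) 1≤) λ ()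

module Incidence {n : ℕ} (H : Hypergraph n) where

  edge : Fin (size H) → Subset n
  edge = List.lookup (edges H)

  edge∈ : ∀ i → edge i ∈ᴱ H
  edge∈ i = ∈-lookup i

  edge-injective : Injective _≡_ _≡_ edge
  edge-injective {i} {j} eq = decidable-stable (i Fin.≟ j) λ i≢j →
    AllPairs-lookup (λ x≢y y≡x → x≢y (sym y≡x)) (unique H) i≢j eq

  edge-surjective : ∀ {e} → e ∈ᴱ H → ∃[ i ] edge i ≡ e
  edge-surjective e∈ = index e∈ , sym (lookup-index e∈)

  deg : Fin n → ℕ
  deg v = ∑[ i < size H ] mem (edge i) v

  -- For distinct vertices of a linear hypergraph this is 0 or 1 and so indicates adjacency; on the
  -- diagonal it is the degree.
  codeg : Fin n → Fin n → ℕ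
  codeg x v = ∑[ i < size H ] (mem (edge i) x * mem (edge i) v)

  codeg-self : ∀ v → codeg v v ≡ deg v
  codeg-self v = sum-cong-≗ λ i → mem-idem (edge i) v

  both-∈ : ∀ {x v} i → 1 ≤ mem (edge i) x * mem (edge i) v → x ∈ edge i × v ∈ edge i
  both-∈ {x} {v} i 1≤ =
    let p , q = *-positive (mem (edge i) x) (mem (edge i) v) 1≤ in mem-positive p , mem-positive q

  codeg-positive⁻ : ∀ {x v} → 1 ≤ codeg x v → ∃[ i ] x ∈ edge i × v ∈ edge i
  codeg-positive⁻ 1≤ = let i , p = ∑-positive _ 1≤ in i , both-∈ i p

  codeg-positive⁺ : ∀ {x v i} → x ∈ edge i → v ∈ edge i → 1 ≤ codeg x v
  codeg-positive⁺ {x} {v} {i} x∈ v∈ = ℕ.≤-trans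
    (ℕ.≤-reflexive (sym (cong₂ _*_ (mem-∈ x∈) (mem-∈ v∈)))) (term≤∑ _ i)

  weighted-handshake : (weight : Fin n → ℕ) →
    ∑[ i < size H ] (∑[ v < n ] (weight v * mem (edge i) v)) ≡ ∑[ v < n ] (weight v * deg v)
  weighted-handshake weight = trans (∑-comm λ i v → weight v * mem (edge i) v)
    (sum-cong-≗ λ v → sym (*-distribˡ-sum (weight v) λ i → mem (edge i) v))

  -- Counts the pairs of an edge through `v` and a vertex of `f` on it, first by edges and then by
  -- vertices.
  ∑-∣∩∣ : ∀ f v →
    ∑[ i < size H ] (mem (edge i) v * ∣ f ∩ edge i ∣) ≡ ∑[ x < n ] (mem f x * codeg x v)
  ∑-∣∩∣ f v = begin
    ∑[ i < size H ] (mem (edge i) v * ∣ f ∩ edge i ∣)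
      ≡⟨ sum-cong-≗ (λ i → cong (mem (edge i) v *_)
           (trans (∣∣≡∑ (f ∩ edge i)) (sum-cong-≗ (mem-∩ f (edge i))))) ⟩
    ∑[ i < size H ] (mem (edge i) v * ∑[ x < n ] (mem f x * mem (edge i) x))
      ≡⟨ sum-cong-≗ (λ i → *-distribˡ-sum (mem (edge i) v) (λ x → mem f x * mem (edge i) x)) ⟩
    ∑[ i < size H ] (∑[ x < n ] (mem (edge i) v * (mem f x * mem (edge i) x)))
      ≡⟨ ∑-comm (λ i x → mem (edge i) v * (mem f x * mem (edge i) x)) ⟩
    ∑[ x < n ] (∑[ i < size H ] (mem (edge i) v * (mem f x * mem (edge i) x)))
      ≡⟨ sum-cong-≗ (λ x → trans
           (sum-cong-≗ (λ i → rearrange (mem (edge i) v) (mem f x) (mem (edge i) x)))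
           (sym (*-distribˡ-sum (mem f x) λ i → mem (edge i) x * mem (edge i) v))) ⟩
    ∑[ x < n ] (mem f x * codeg x v) ∎
    where
    open ≡-Reasoning
    rearrange : ∀ a b c → a * (b * c) ≡ b * (c * a)
    rearrange = solve-∀

  -- Every edge through `v` that meets `f` is counted at least once in the sum, and at most one edge
  -- through `v` misses `f`.
  deg≤1+∑ : ∀ {f v} →
    (∀ {i j} → v ∈ edge i → v ∈ edge j → Disjoint (edge i) f → Disjoint (edge j) f → i ≡ j) →
    deg v ≤ 1 + ∑[ x < n ] (mem f x * codeg x v)
  deg≤1+∑ {f} {v} one-missed = begin
    deg v
      ≤⟨ ∑-mono (λ i → ℕ.≤-trans (ℕ.m≤n+m∸n (mem (edge i) v) (met i))
           (ℕ.≤-reflexive (ℕ.+-comm (met i) _))) ⟩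
    ∑[ i < size H ] (missed i + met i)
      ≡⟨ ∑-distrib-+ missed met ⟩
    sum missed + sum met
      ≤⟨ ℕ.+-mono-≤
           (∑≤1 missed≤1 λ i j p q → one-missed (through p) (through q) (avoids p) (avoids q))
           (ℕ.≤-reflexive (∑-∣∩∣ f v)) ⟩
    1 + ∑[ x < n ] (mem f x * codeg x v) ∎
    where
    open ℕ.≤-Reasoning
    met missed : Fin (size H) → ℕ
    met i = mem (edge i) v * ∣ f ∩ edge i ∣
    -- Truncated subtraction gives 1 exactly when the edge contains `v` and misses `f`, and 0
    -- otherwise.
    missed i = mem (edge i) v ∸ met i

    missed≤1 : ∀ i → missed i ≤ 1
    missed≤1 i = ℕ.≤-trans (ℕ.m∸n≤m _ (met i)) (mem≤1 (edge i) v)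

    through : ∀ {i} → 1 ≤ missed i → v ∈ edge i
    through {i} 1≤ = mem-positive (ℕ.≤-trans 1≤ (ℕ.m∸n≤m _ (met i)))

    avoids : ∀ {i} → 1 ≤ missed i → Disjoint (edge i) f
    avoids {i} 1≤ {x} x∈i x∈f = ℕ.<⇒≱ 1≤ (ℕ.≤-reflexive (ℕ.m≤n⇒m∸n≡0 (begin
      mem (edge i) v     ≡⟨ ℕ.*-identityʳ _ ⟨
      mem (edge i) v * 1 ≤⟨ ℕ.*-monoʳ-≤ (mem (edge i) v) 1≤∣∩∣ ⟩
      met i              ∎)))
      where
      1≤∣∩∣ : 1 ≤ ∣ f ∩ edge i ∣
      1≤∣∩∣ = begin
        1                  ≡⟨ mem-∈ (x∈p∩q⁺ (x∈f , x∈i)) ⟨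
        mem (f ∩ edge i) x ≤⟨ term≤∑ _ x ⟩
        sum (mem (f ∩ edge i)) ≡⟨ ∣∣≡∑ (f ∩ edge i) ⟨
        ∣ f ∩ edge i ∣     ∎

  module _ {r : ℕ} (uniform : Uniform r H) where

    ∑-edge : ∀ i → sum (mem (edge i)) ≡ r
    ∑-edge i = trans (sym (∣∣≡∑ (edge i))) (uniform _ (edge∈ i))

    ∑-codeg : ∀ v → ∑[ x < n ] codeg x v ≡ r * deg v
    ∑-codeg v = begin
      ∑[ x < n ] codeg x v
        ≡⟨ ∑-comm (λ x i → mem (edge i) x * mem (edge i) v) ⟩
      ∑[ i < size H ] (∑[ x < n ] (mem (edge i) x * mem (edge i) v))
        ≡⟨ sum-cong-≗ (λ i → trans (sum-cong-≗ λ x → ℕ.*-comm (mem (edge i) x) _)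
             (sym (*-distribˡ-sum (mem (edge i) v) (mem (edge i))))) ⟩
      ∑[ i < size H ] (mem (edge i) v * sum (mem (edge i)))
        ≡⟨ sum-cong-≗ (λ i → trans (cong (mem (edge i) v *_) (∑-edge i)) (ℕ.*-comm _ r)) ⟩
      ∑[ i < size H ] (r * mem (edge i) v)
        ≡⟨ *-distribˡ-sum r (λ i → mem (edge i) v) ⟨
      r * deg v ∎
      where open ≡-Reasoning

    -- The codegrees with `v` are summed in two ways. Each vertex of `X` other than `v` contributes
    -- 1, while `v` contributes `deg v` in place of 1; the added 1 on the left avoids a subtraction.
    neighbourhood-size : ∀ {X v} → v ∈ X → (∀ {x} → x ≢ v → x ∈ X → codeg x v ≡ 1) →
      (∀ {x} → x ∉ X → codeg x v ≡ 0) → r * deg v + 1 ≡ ∣ X ∣ + deg v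
    neighbourhood-size {X} {v} v∈X inside outside = begin
      r * deg v + 1
        ≡⟨ cong₂ _+_ (∑-codeg v) (∑-⁅⁆ v) ⟨
      ∑[ x < n ] codeg x v + sum (mem ⁅ v ⁆)
        ≡⟨ ∑-distrib-+ (λ x → codeg x v) (mem ⁅ v ⁆) ⟨
      ∑[ x < n ] (codeg x v + mem ⁅ v ⁆ x)
        ≡⟨ sum-cong-≗ pointwise ⟩
      ∑[ x < n ] (mem X x + deg v * mem ⁅ v ⁆ x)
        ≡⟨ ∑-distrib-+ (mem X) (λ x → deg v * mem ⁅ v ⁆ x) ⟩
      sum (mem X) + ∑[ x < n ] (deg v * mem ⁅ v ⁆ x)
        ≡⟨ cong₂ _+_ (∣∣≡∑ X) (trans
             (sym (trans (cong (deg v *_) (∑-⁅⁆ v)) (ℕ.*-identityʳ _)))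
             (*-distribˡ-sum (deg v) (mem ⁅ v ⁆))) ⟨
      ∣ X ∣ + deg v ∎
      where
      open ≡-Reasoning
      pointwise : ∀ x → codeg x v + mem ⁅ v ⁆ x ≡ mem X x + deg v * mem ⁅ v ⁆ x
      pointwise x with x Fin.≟ v
      ... | yes refl rewrite codeg-self v | mem-∈ (x∈⁅x⁆ v) | mem-∈ v∈X =
        trans (ℕ.+-comm (deg v) 1) (cong suc (sym (ℕ.*-identityʳ (deg v))))
      ... | no x≢v rewrite mem-⁅⁆≢ x≢v | ℕ.*-zeroʳ (deg v) with x ∈? X
      ...   | yes x∈X rewrite inside x≢v x∈X | mem-∈ x∈X = refl
      ...   | no  x∉X rewrite outside x∉X | mem-∉ x∉X = refl

    module _ (linear : Linear H) where

      codeg≤1 : ∀ {x v} → x ≢ v → codeg x v ≤ 1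
      codeg≤1 {x} {v} x≢v = ∑≤1 (λ i → ℕ.*-mono-≤ (mem≤1 (edge i) x) (mem≤1 (edge i) v)) λ i j p q →
        decidable-stable (i Fin.≟ j) λ i≢j → x≢v (linear-meet {H = H} linear (edge∈ i) (edge∈ j)
          (λ eq → i≢j (edge-injective eq)) (proj₁ (both-∈ i p)) (proj₁ (both-∈ j q))
          (proj₂ (both-∈ i p)) (proj₂ (both-∈ j q)))

      codeg≡1 : ∀ {x v i} → x ≢ v → x ∈ edge i → v ∈ edge i → codeg x v ≡ 1
      codeg≡1 x≢v x∈ v∈ = ℕ.≤-antisym (codeg≤1 x≢v) (codeg-positive⁺ x∈ v∈)

      -- The edges i and j through v miss f, every other one meets it at most once.
      ∑+2≤deg : ∀ {f v i j} → f ∈ᴱ H → v ∉ f → v ∈ edge i → v ∈ edge j → i ≢ j →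
        Disjoint (edge i) f → Disjoint (edge j) f → ∑[ x < n ] (mem f x * codeg x v) + 2 ≤ deg v
      ∑+2≤deg {f} {v} {i} {j} f∈H v∉f v∈i v∈j i≢j i∥f j∥f = begin
        ∑[ x < n ] (mem f x * codeg x v) + 2
          ≡⟨ cong₂ _+_ (∑-∣∩∣ f v) (cong₂ _+_ (∑-⁅⁆ i) (∑-⁅⁆ j)) ⟨
        sum met + (sum (mem ⁅ i ⁆) + sum (mem ⁅ j ⁆))
          ≡⟨ cong (sum met +_) (∑-distrib-+ (mem ⁅ i ⁆) (mem ⁅ j ⁆)) ⟨
        sum met + ∑[ k < size H ] (mem ⁅ i ⁆ k + mem ⁅ j ⁆ k)
          ≡⟨ ∑-distrib-+ met (λ k → mem ⁅ i ⁆ k + mem ⁅ j ⁆ k) ⟨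
        ∑[ k < size H ] (met k + (mem ⁅ i ⁆ k + mem ⁅ j ⁆ k))
          ≤⟨ ∑-mono pointwise ⟩
        deg v ∎
        where
        open ℕ.≤-Reasoning
        met : Fin (size H) → ℕ
        met k = mem (edge k) v * ∣ f ∩ edge k ∣

        ∣f∩∣≡0 : ∀ {e} → Disjoint e f → ∣ f ∩ e ∣ ≡ 0
        ∣f∩∣≡0 {e} e∥f = trans (cong ∣_∣ (Empty-unique λ (x , x∈) →
          let x∈f , x∈e = x∈p∩q⁻ f e x∈ in e∥f x∈e x∈f)) (∣⊥∣≡0 n)

        met≤ : ∀ k → met k ≤ mem (edge k) v
        met≤ k with f ≟ˢ edge k
        -- Linearity does not bound the intersection of `f` with itself, but `v ∉ f` makes both
        -- sides 0.
        ... | yes f≡k = ℕ.≤-reflexive (trans (cong (_* _) v∉k) (sym v∉k))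
          where
          v∉k : mem (edge k) v ≡ 0
          v∉k = mem-∉ (subst (v ∉_) f≡k v∉f)
        ... | no  f≢k = ℕ.≤-trans (ℕ.*-monoʳ-≤ (mem (edge k) v) (linear _ _ f∈H (edge∈ k) f≢k))
          (ℕ.≤-reflexive (ℕ.*-identityʳ _))

        pointwise : ∀ k → met k + (mem ⁅ i ⁆ k + mem ⁅ j ⁆ k) ≤ mem (edge k) v
        pointwise k with k Fin.≟ i | k Fin.≟ j
        ... | yes refl | yes refl = contradiction refl i≢j
        ... | yes refl | no  k≢j
          rewrite ∣f∩∣≡0 i∥f | mem-∈ v∈i | mem-∈ (x∈⁅x⁆ i) | mem-⁅⁆≢ k≢j = ℕ.≤-refl
        ... | no  k≢i | yes refl
          rewrite ∣f∩∣≡0 j∥f | mem-∈ v∈j | mem-∈ (x∈⁅x⁆ j) | mem-⁅⁆≢ k≢i = ℕ.≤-refl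
        ... | no  k≢i | no  k≢j rewrite mem-⁅⁆≢ k≢i | mem-⁅⁆≢ k≢j =
          ℕ.≤-trans (ℕ.≤-reflexive (ℕ.+-identityʳ _)) (met≤ k)

-- Extremal hypergraphs

-- The tests are made in order, so the middle value belongs to degrees from 2 to `r + 1`. The value
-- `r` for degrees at most 1 pays for the 0 of a vertex of large degree on the same edge.
weight : ℕ → ℕ → ℕ
weight r d with d ≤? 1 | d ≤? suc r
... | yes _ | _     = r
... | no  _ | yes _ = 1
... | no  _ | no  _ = 0

weight*d≤ : ∀ r d → weight r d * d ≤ suc r
weight*d≤ r d with d ≤? 1 | d ≤? suc r
... | yes d≤1 | _       =
  ℕ.≤-trans (ℕ.*-monoʳ-≤ r d≤1) (ℕ.≤-trans (ℕ.≤-reflexive (ℕ.*-identityʳ r)) (ℕ.n≤1+n r))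
... | no  _   | yes d≤r = ℕ.≤-trans (ℕ.≤-reflexive (ℕ.+-identityʳ d)) d≤r
... | no  _   | no  _   = z≤n

-- The product is at most `r` in the first branch and 0 in the last; in the middle one it is the
-- degree itself.
weight*d≡⇒ : ∀ r d → weight r d * d ≡ suc r → d ≡ suc r
weight*d≡⇒ r d eq with d ≤? 1 | d ≤? suc r
... | yes d≤1 | _     = contradiction
  (subst (_≤ r) eq (ℕ.≤-trans (ℕ.*-monoʳ-≤ r d≤1) (ℕ.≤-reflexive (ℕ.*-identityʳ r))))
  (ℕ.<-irrefl refl)
... | no  _   | yes _ = trans (sym (ℕ.+-identityʳ d)) eq
weight*d≡⇒ r d () | no _ | no _

weight-light : ∀ r d → d ≤ 1 → weight r d ≡ r
weight-light r d d≤1 with d ≤? 1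
... | yes _ = refl
... | no  d≰1 = contradiction d≤1 d≰1

weight-positive : ∀ r d → 1 ≤ r → d ≤ suc r → 1 ≤ weight r d
weight-positive r d 1≤r d≤r with d ≤? 1 | d ≤? suc r
... | yes _ | _       = 1≤r
... | no  _ | yes _   = s≤s z≤n
... | no  _ | no  d≰r = contradiction d≤r d≰r

module Extremal {n r : ℕ} (H : Hypergraph n) (2≤r : 2 ≤ r)
  (uniform : Uniform r H) (linear : Linear H) (free : ¬ B₄-Configuration H) where

  open Incidence H

  private
    1≤r : 1 ≤ r
    1≤r = ℕ.≤-trans (s≤s z≤n) 2≤r

    module _ {v w : Fin n} {i j : Fin (size H)}
      (v∈i : v ∈ edge i) (w∈i : w ∈ edge i) (w∈j : w ∈ edge j) (v∉j : v ∉ edge j) where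

      -- The edges `i` and `j` take the places of `e` and `f`, so two different edges through `v`
      -- that miss `edge j` would complete a configuration.
      deg≤1+met : deg v ≤ 1 + ∑[ x < n ] (mem (edge j) x * codeg x v)
      deg≤1+met = deg≤1+∑ λ {k} {l} v∈k v∈l k∥j l∥j → decidable-stable (k Fin.≟ l) λ k≢l →
        free record
          { g₁∈H = edge∈ k ; g₂∈H = edge∈ l ; e∈H = edge∈ i ; f∈H = edge∈ j
          ; v∈g₁ = v∈k ; v∈g₂ = v∈l ; v∈e = v∈i ; w∈e = w∈i ; w∈f = w∈j ; v∉f = v∉j
          ; g₁≢g₂ = λ eq → k≢l (edge-injective eq) ; g₁∥f = k∥j ; g₂∥f = l∥j }

      met≤ : ∀ x → mem (edge j) x * codeg x v ≤ mem (edge j) x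
      met≤ x with x Fin.≟ v
      -- Here the codegree is a degree and may exceed 1, but `v` is not on `edge j`.
      ... | yes refl = ℕ.≤-reflexive (trans (cong (_* codeg x x) (mem-∉ v∉j)) (sym (mem-∉ v∉j)))
      ... | no  x≢v  = ℕ.≤-trans (ℕ.*-monoʳ-≤ (mem (edge j) x) (codeg≤1 uniform linear x≢v))
        (ℕ.≤-reflexive (ℕ.*-identityʳ _))

      deg≤1+r : deg v ≤ suc r
      deg≤1+r = ℕ.≤-trans deg≤1+met
        (s≤s (ℕ.≤-trans (∑-mono met≤) (ℕ.≤-reflexive (∑-edge uniform j))))

      -- Degree `r + 1` forces equality in `met≤` for every vertex, so each vertex of `edge j` has
      -- positive codegree with `v`. Transitivity of adjacency rests on this.
      saturated : deg v ≡ suc r → ∀ {x} → x ∈ edge j → ∃[ k ] x ∈ edge k × v ∈ edge k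
      saturated deg≡ {x} x∈j = codeg-positive⁻ (ℕ.≤-trans (ℕ.≤-reflexive (trans (sym (mem-∈ x∈j))
        (trans (sym (∑-tight met≤ r≤met x)) (cong (_* codeg x v) (mem-∈ x∈j)))))
        (ℕ.≤-reflexive (ℕ.*-identityˡ _)))
        where
        r≤met : sum (mem (edge j)) ≤ ∑[ x < n ] (mem (edge j) x * codeg x v)
        r≤met = ℕ.≤-pred
          (ℕ.≤-trans (ℕ.≤-reflexive (trans (cong suc (∑-edge uniform j)) (sym deg≡))) deg≤1+met)

    -- By linearity a second edge through `w` would avoid `v`, and `deg≤1+r` would then bound the
    -- degree of `v`.
    light-neighbour : ∀ {v w i} → suc r < deg v → v ∈ edge i → w ∈ edge i → w ≢ v → deg w ≤ 1
    light-neighbour {v} {w} {i} heavy v∈i w∈i w≢v = ∑≤1 (λ j → mem≤1 (edge j) w) λ j k p q →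
      trans (≡i (mem-positive p)) (sym (≡i (mem-positive q)))
      where
      ≡i : ∀ {j} → w ∈ edge j → j ≡ i
      ≡i {j} w∈j = decidable-stable (j Fin.≟ i) λ j≢i → ℕ.<⇒≱ heavy
        (deg≤1+r {w = w} {i = i} {j = j} v∈i w∈i w∈j λ v∈j → w≢v
          (linear-meet {H = H} linear (edge∈ j) (edge∈ i) (λ eq → j≢i (edge-injective eq))
            w∈j w∈i v∈j v∈i))

    wt : Fin n → ℕ
    wt v = weight r (deg v)

    -- If the edge has a vertex of degree above `r + 1`, any other vertex on it is light and alone
    -- contributes `r`. Otherwise each of its `r` vertices contributes at least 1.
    edge-weight : ∀ i → r ≤ ∑[ v < n ] (wt v * mem (edge i) v)
    edge-weight i with Fin.any? (λ v → (v ∈? edge i) ×-dec (suc (suc r) ≤? deg v))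
    ... | yes (v , v∈i , heavy) = begin
      r                     ≡⟨ weight-light r (deg w) (light-neighbour heavy v∈i w∈i w≢v) ⟨
      wt w                  ≡⟨ ℕ.*-identityʳ _ ⟨
      wt w * 1              ≡⟨ cong (wt w *_) (mem-∈ w∈i) ⟨
      wt w * mem (edge i) w ≤⟨ term≤∑ (λ v → wt v * mem (edge i) v) w ⟩
      ∑[ v < n ] (wt v * mem (edge i) v) ∎
      where
      open ℕ.≤-Reasoning
      second : ∃[ w ] w ∈ edge i × w ≢ v
      second = another-element (subst (2 ≤_) (sym (uniform _ (edge∈ i))) 2≤r) v
      w = proj₁ second
      w∈i = proj₁ (proj₂ second)
      w≢v = proj₂ (proj₂ second)
    ... | no none = ℕ.≤-trans (ℕ.≤-reflexive (sym (∑-edge uniform i))) (∑-mono pointwise)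
      where
      pointwise : ∀ v → mem (edge i) v ≤ wt v * mem (edge i) v
      pointwise v with v ∈? edge i
      ... | yes v∈i = ℕ.≤-trans (ℕ.≤-reflexive (sym (ℕ.*-identityˡ _)))
        (ℕ.*-monoˡ-≤ (mem (edge i) v)
          (weight-positive r (deg v) 1≤r (ℕ.≮⇒≥ λ heavy → none (v , v∈i , heavy))))
      ... | no  v∉i = ℕ.≤-trans (ℕ.≤-reflexive (mem-∉ v∉i)) z≤n

    r*size≤∑ : r * size H ≤ ∑[ v < n ] (wt v * deg v)
    r*size≤∑ = begin
      r * size H          ≡⟨ ℕ.*-comm r (size H) ⟩
      size H * r          ≡⟨ ∑-const (size H) r ⟨
      ∑[ i < size H ] r   ≤⟨ ∑-mono edge-weight ⟩
      ∑[ i < size H ] (∑[ v < n ] (wt v * mem (edge i) v)) ≡⟨ weighted-handshake wt ⟩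
      ∑[ v < n ] (wt v * deg v) ∎
      where open ℕ.≤-Reasoning

    ∑≡[r+1]*n : ∑[ v < n ] suc r ≡ (r + 1) * n
    ∑≡[r+1]*n = trans (∑-const n (suc r)) (trans (ℕ.*-comm n (suc r)) (cong (_* n) (ℕ.+-comm 1 r)))

  size-bound : r * size H ≤ (r + 1) * n
  size-bound = ℕ.≤-trans r*size≤∑
    (ℕ.≤-trans (∑-mono λ v → weight*d≤ r (deg v)) (ℕ.≤-reflexive ∑≡[r+1]*n))

  module _ (extremal : r * size H ≡ (r + 1) * n) where

    -- Equality in `size-bound` leaves no slack at any vertex, so weight times degree is `r + 1`
    -- everywhere.
    regular : ∀ v → deg v ≡ suc r
    regular v = weight*d≡⇒ r (deg v) (∑-tight (λ v → weight*d≤ r (deg v))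
      (ℕ.≤-trans (ℕ.≤-reflexive (trans ∑≡[r+1]*n (sym extremal))) r*size≤∑) v)

    infix 4 _~_ _~?_

    _~_ : Fin n → Fin n → Set
    x ~ y = ∃[ i ] x ∈ edge i × y ∈ edge i

    _~?_ : ∀ x y → Dec (x ~ y)
    x ~? y = Fin.any? λ i → (x ∈? edge i) ×-dec (y ∈? edge i)

    ~-refl : ∀ {x} → x ~ x
    ~-refl {x} =
      let i , 1≤ = ∑-positive _ (subst (1 ≤_) (sym (regular x)) (s≤s z≤n)) in
      i , mem-positive 1≤ , mem-positive 1≤

    ~-sym : ∀ {x y} → x ~ y → y ~ x
    ~-sym (i , x∈ , y∈) = i , y∈ , x∈

    ~-trans : ∀ {x y z} → x ~ y → y ~ z → x ~ z
    ~-trans {x} (i , x∈i , y∈i) (j , y∈j , z∈j) with x ∈? edge j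
    ... | yes x∈j = j , x∈j , z∈j
    -- The path from `x` over `y` along `edge j` is the situation of `saturated`, with `x` as `v`
    -- and `y` as `w`; hence `z` is a neighbour of `x`.
    ... | no  x∉j = ~-sym (saturated x∈i y∈i y∈j x∉j (regular x) z∈j)

    adjacency : DecSetoid 0ℓ 0ℓ
    adjacency = record
      { _≈_ = _~_
      ; isDecEquivalence = record
        { isEquivalence = record { refl = ~-refl ; sym = ~-sym ; trans = ~-trans }
        ; _≟_ = _~?_ } }

    -- One vertex is kept from each adjacency class, and the positions in this list index the parts.
    representatives : List (Fin n)
    representatives = List.deduplicate _~?_ (List.allFin n)

    rep : Fin (List.length representatives) → Fin n
    rep = List.lookup representatives

    covered : ∀ x → ∃[ i ] x ~ rep i
    covered x = index x∈ , lookup-index x∈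
      where
      x∈ : Any (x ~_) representatives
      x∈ = ∈-deduplicate⁺ (DecSetoid.setoid adjacency) _~?_ (λ y~z w~z → ~-trans w~z (~-sym y~z))
        (Any.map (λ { refl → ~-refl }) (∈-allFin x))

    rep-injective : ∀ {i j} → rep i ~ rep j → i ≡ j
    rep-injective {i} {j} i~j = decidable-stable (i Fin.≟ j) λ i≢j →
      AllPairs-lookup (λ x≁y y~x → x≁y (~-sym y~x))
        (deduplicate-! adjacency (List.allFin n)) i≢j i~j

    class : Fin n → Subset n
    class v = tabulate λ x → does (x ~? v)

    ∈-class⁺ : ∀ {x v} → x ~ v → x ∈ class v
    ∈-class⁺ {x} {v} x~v = lookup⇒[]= x _ (trans (Vec.lookup∘tabulate _ x) (dec-true (x ~? v) x~v))

    ∈-class⁻ : ∀ {x v} → x ∈ class v → x ~ v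
    ∈-class⁻ {x} {v} x∈ with x ~? v | trans (sym (Vec.lookup∘tabulate _ x)) ([]=⇒lookup x∈)
    ... | yes x~v | _ = x~v

    edge⊆class : ∀ {v x i} → x ~ v → x ∈ edge i → edge i ⊆ class v
    edge⊆class {i = i} x~v x∈i y∈i = ∈-class⁺ (~-trans (i , y∈i , x∈i) x~v)

    -- The class consists of `v` and its neighbours, so `neighbourhood-size` with degree `r + 1`
    -- determines its size.
    ∣class∣ : ∀ v → ∣ class v ∣ ≡ r ^ 2
    ∣class∣ v = ℕ.+-cancelʳ-≡ (suc r) _ _ (begin
      ∣ class v ∣ + suc r ≡⟨ cong (∣ class v ∣ +_) (regular v) ⟨
      ∣ class v ∣ + deg v
        ≡⟨ neighbourhood-size uniform (∈-class⁺ ~-refl)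
             (λ x≢v x∈ → let i , x∈i , v∈i = ∈-class⁻ x∈ in codeg≡1 uniform linear x≢v x∈i v∈i)
             (λ x∉ → ℕ.n<1⇒n≡0 (ℕ.≰⇒> λ 1≤ → x∉ (∈-class⁺ (codeg-positive⁻ 1≤)))) ⟨
      r * deg v + 1       ≡⟨ cong (λ d → r * d + 1) (regular v) ⟩
      r * suc r + 1       ≡⟨ arithmetic r ⟩
      r ^ 2 + suc r       ∎)
      where
      open ≡-Reasoning
      arithmetic : ∀ r → r * suc r + 1 ≡ r * (r * 1) + suc r
      arithmetic = solve-∀

    -- By `edge⊆class` the edges inside the class are the same as the edges that meet it.
    block : Fin n → Hypergraph n
    block v = hypergraph (List.filter (_⊆? class v) (edges H)) (filter⁺ (_⊆? class v) (unique H))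

    ∈-block⁻ : ∀ {v e} → e ∈ᴱ block v → e ∈ᴱ H × e ⊆ class v
    ∈-block⁻ {v} = ∈-filter⁻ (_⊆? class v)

    ∈-block⁺ : ∀ {v e} → e ∈ᴱ H → e ⊆ class v → e ∈ᴱ block v
    ∈-block⁺ {v} e∈H e⊆ = ∈-filter⁺ (_⊆? class v) e∈H (λ {x} → e⊆ {x})

    -- Two points of a class share an edge by transitivity, and by linearity only one.
    block-steiner : ∀ v → IsSteinerSystem r (r ^ 2) (class v) (block v)
    block-steiner v = record
      { points    = ∣class∣ v
      ; supported = λ e e∈ {x} → proj₂ (∈-block⁻ {v} {e} e∈) {x}
      ; uniform   = λ e e∈ → uniform e (proj₁ (∈-block⁻ {v} e∈))
      ; pairs     = λ x y x∈ y∈ x≢y →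
          let i , x∈i , y∈i = ~-trans (∈-class⁻ x∈) (~-sym (∈-class⁻ y∈)) in
          edge i ,
          (∈-block⁺ (edge∈ i) (edge⊆class (∈-class⁻ x∈) x∈i) , x∈i , y∈i) ,
          λ {e} (e∈ , x∈e , y∈e) → decidable-stable (edge i ≟ˢ e) λ i≢e →
            x≢y (linear-meet {H = H} linear (edge∈ i) (proj₁ (∈-block⁻ {v} e∈)) i≢e x∈i x∈e y∈i y∈e)
      }

    disjoint-union : IsDisjointUnionOfSteinerSystems r (r ^ 2) H
    disjoint-union = record
      { count     = List.length representatives
      ; part      = class ∘ rep
      ; system    = block ∘ rep
      ; steiner   = block-steiner ∘ rep
      ; partition = λ x → let i , x~i = covered x in
          i , ∈-class⁺ x~i , λ x∈j → rep-injective (~-trans (~-sym x~i) (∈-class⁻ x∈j))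
      ; union     = λ e → mk⇔ to λ (i , e∈) → proj₁ (∈-block⁻ {rep i} e∈)
      }
      where
      to : ∀ {e} → e ∈ᴱ H → ∃[ i ] e ∈ᴱ block (rep i)
      to {e} e∈H with k , refl ← edge-surjective e∈H =
        -- An edge is nonempty as `1 ≤ r`, and the class of any of its vertices contains it.
        let x , 1≤ = ∑-positive (mem (edge k)) (subst (1 ≤_) (sym (∑-edge uniform k)) 1≤r)
            i , x~i = covered x
        in i , ∈-block⁺ e∈H (edge⊆class x~i (mem-positive 1≤))

-- Disjoint unions of Steiner systems

module DisjointUnion {n r : ℕ} (H : Hypergraph n) (2≤r : 2 ≤ r)
  (uniform : Uniform r H) (linear : Linear H)
  (disjoint-union : IsDisjointUnionOfSteinerSystems r (r ^ 2) H) where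

  open Incidence H
  open IsDisjointUnionOfSteinerSystems disjoint-union
  open IsSteinerSystem using (points; supported; pairs)

  private
    index-of : Fin n → Fin count
    index-of x = proj₁ (partition x)

    part-of : Fin n → Subset n
    part-of x = part (index-of x)

    ∈-part-of : ∀ x → x ∈ part-of x
    ∈-part-of x = proj₁ (proj₂ (partition x))

    -- The edge is a block of some system and lies in the part of that system; as parts do not
    -- overlap, this is the part of `x`.
    edge⊆part : ∀ {x i} → x ∈ edge i → edge i ⊆ part-of x
    edge⊆part {x} {i} x∈i {y} y∈i =
      let j , i∈j = Equivalence.to (union (edge i)) (edge∈ i) in
      subst (λ j → y ∈ part j) (sym (proj₂ (proj₂ (partition x)) (supported (steiner j) _ i∈j x∈i)))
        (supported (steiner j) _ i∈j y∈i)

    joined : ∀ {x v} → x ≢ v → x ∈ part-of v → ∃[ i ] x ∈ edge i × v ∈ edge i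
    joined {x} {v} x≢v x∈ =
      let e , (e∈ , x∈e , v∈e) , _ = pairs (steiner (index-of v)) x v x∈ (∈-part-of v) x≢v
          i , i≡e = edge-surjective (Equivalence.from (union e) (index-of v , e∈))
      in i , subst (x ∈_) (sym i≡e) x∈e , subst (v ∈_) (sym i≡e) v∈e

    codeg-inside : ∀ {x v} → x ≢ v → x ∈ part-of v → codeg x v ≡ 1
    codeg-inside x≢v x∈ = let i , x∈i , v∈i = joined x≢v x∈ in codeg≡1 uniform linear x≢v x∈i v∈i

    -- The part of `v` consists of `v` and its neighbours and has `r ^ 2` points, which gives a
    -- linear equation for the degree.
    regular : ∀ v → deg v ≡ suc r
    regular v = solve-degree r (deg v) 2≤r (trans
      (neighbourhood-size uniform (∈-part-of v) codeg-inside
        (λ x∉ → ℕ.n<1⇒n≡0 (ℕ.≰⇒> λ 1≤ →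
          let i , x∈i , v∈i = codeg-positive⁻ 1≤ in x∉ (edge⊆part v∈i x∈i))))
      (cong (_+ deg v) (points (steiner (index-of v)))))
      where
      lhs : ∀ s d → suc (suc s) * d + 1 ≡ suc s * d + (d + 1)
      lhs = solve-∀

      rhs : ∀ s d → suc (suc s) * (suc (suc s) * 1) + d ≡ suc s * suc (suc (suc s)) + (d + 1)
      rhs = solve-∀

      -- With `r = s + 2` both sides contain `d + 1`, and what remains is
      -- `(r - 1) d = (r - 1)(r + 1)`; `2 ≤ r` allows cancelling `r - 1`.
      solve-degree : ∀ r d → 2 ≤ r → r * d + 1 ≡ r ^ 2 + d → d ≡ suc r
      solve-degree (suc (suc s)) d _ eq = ℕ.*-cancelˡ-≡ d (3 + s) (suc s)
        (ℕ.+-cancelʳ-≡ (d + 1) _ _ (trans (sym (lhs s d)) (trans eq (rhs s d))))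
      solve-degree (suc zero) d (s≤s ())

  -- Each of the `r` vertices of `f` has codegree 1 with `v`, so together with `g₁` and `g₂`, which
  -- miss `f`, the degree of `v` would be at least `r + 2`.
  configuration-free : ¬ B₄-Configuration H
  configuration-free config = go (edge-surjective g₁∈H) (edge-surjective g₂∈H) (edge-surjective e∈H)
    where
    open B₄-Configuration config

    go : ∃[ i ] edge i ≡ g₁ → ∃[ j ] edge j ≡ g₂ → ∃[ k ] edge k ≡ e → ⊥
    go (i , refl) (j , refl) (k , refl) = ℕ.<⇒≱ (ℕ.≤-reflexive (ℕ.+-comm 2 r)) (begin
      r + 2
        ≡⟨ cong (_+ 2) (trans (sym (uniform f f∈H)) (trans (∣∣≡∑ f) (sum-cong-≗ pointwise))) ⟩
      ∑[ x < n ] (mem f x * codeg x v) + 2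
        ≤⟨ ∑+2≤deg uniform linear f∈H v∉f v∈g₁ v∈g₂ (λ i≡j → g₁≢g₂ (cong edge i≡j)) g₁∥f g₂∥f ⟩
      deg v
        ≡⟨ regular v ⟩
      suc r ∎)
      where
      open ℕ.≤-Reasoning
      f⊆part : f ⊆ part-of v
      -- The edge `e` places `w` in the part of `v`, and `f` stays in the part of `w`.
      f⊆part {x} x∈f =
        let l , l≡f = edge-surjective f∈H
            x∈w = edge⊆part {w} {l} (subst (w ∈_) (sym l≡f) w∈f) (subst (x ∈_) (sym l≡f) x∈f)
        in subst (λ i → x ∈ part i) (proj₂ (proj₂ (partition w)) (edge⊆part v∈e w∈e)) x∈w

      pointwise : ∀ x → mem f x ≡ mem f x * codeg x v
      pointwise x with x ∈? f
      ... | yes x∈f = sym (trans (cong (mem f x *_)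
        (codeg-inside (λ { refl → v∉f x∈f }) (f⊆part x∈f))) (ℕ.*-identityʳ _))
      ... | no  x∉f = trans (mem-∉ x∉f) (sym (cong (_* codeg x v) (mem-∉ x∉f)))

  -- Double counting of incidences with constant weight 1 in an `r`-uniform hypergraph that is
  -- regular of degree `r + 1`.
  size-formula : r * size H ≡ (r + 1) * n
  size-formula = begin
    r * size H
      ≡⟨ ℕ.*-comm r (size H) ⟩
    size H * r
      ≡⟨ ∑-const (size H) r ⟨
    ∑[ i < size H ] r
      ≡⟨ sum-cong-≗ (λ i → trans (sum-cong-≗ (λ v → ℕ.*-identityˡ (mem (edge i) v))) (∑-edge uniform i)) ⟨
    ∑[ i < size H ] (∑[ v < n ] (1 * mem (edge i) v))
      ≡⟨ weighted-handshake (λ _ → 1) ⟩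
    ∑[ v < n ] (1 * deg v)
      ≡⟨ sum-cong-≗ (λ v → trans (ℕ.*-identityˡ (deg v)) (regular v)) ⟩
    ∑[ v < n ] suc r
      ≡⟨ ∑-const n (suc r) ⟩
    n * suc r
      ≡⟨ ℕ.*-comm n (suc r) ⟩
    suc r * n
      ≡⟨ cong (_* n) (ℕ.+-comm 1 r) ⟩
    (r + 1) * n ∎
    where open ≡-Reasoning

-- Multiplication by `r` expresses the quotient `(r + 1) n / r` within the natural numbers, with no
-- rounding.
theorem3 : (r n : ℕ) → 3 ≤ r → 1 ≤ n →
    (r * exˡⁱⁿ r n (expansion r B₄) ≤ (r + 1) * n)
    × (SteinerSystemExists r (r ^ 2) →
    (H : Hypergraph n) → Uniform r H → Linear H →
    (Free (expansion r B₄) H × r * size H ≡ (r + 1) * n)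
    ⇔ IsDisjointUnionOfSteinerSystems r (r ^ 2) H)
theorem3 r n 3≤r _ = turán-bound , λ _ H uniform linear → mk⇔
  (λ (free , extremal) → Extremal.disjoint-union H 2≤r uniform linear
    (λ config → free (configuration⇒contains 2≤r uniform linear config)) extremal)
  (λ union →
    (λ contains → DisjointUnion.configuration-free H 2≤r uniform linear union
      (contains⇒configuration {r = r} contains)) ,
    DisjointUnion.size-formula H 2≤r uniform linear union)
  where
  2≤r : 2 ≤ r
  2≤r = ℕ.≤-trans (ℕ.n≤1+n 2) 3≤r

  turán-bound : r * exˡⁱⁿ r n (expansion r B₄) ≤ (r + 1) * n
  turán-bound =
    -- The Turán number is the size of an actual hypergraph, to which `size-bound` applies.
    let H , (uniform , linear , free) , size≡ =
          IsLinearTuránNumber.attained (proj₂ (linearTuránNumber r n (expansion r B₄)))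
    in subst (λ k → r * k ≤ (r + 1) * n) size≡ (Extremal.size-bound H 2≤r uniform linear
         (λ config → free (configuration⇒contains 2≤r uniform linear config)))
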